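{- Let $r,t\geq 2$ be integers. There is a constant $\alpha=\alpha(r,t)$ such that the following holds. Let $G$ be an $n$-vertex graph with $e(G)\geq \alpha n^{2-\frac{1}{t}+\frac{1}{r}}$ edges, where $n^{t/r}>6t\ln(2nr)$ and $n\geq t^2$. Then $G$ contains a subgraph $G^*$ with $\delta(G^*)\geq 2t$, $\mathrm{rad}(G^*)\leq r$ and $n(G^*)<rt^2+rt$.
   Context: $n(H)$, $e(H)$, $\delta(H)$ and $\mathrm{rad}(H)$ denote the number of vertices, number of edges, minimum degree and radius of a graph $H$. -}

module Defs where

open import Data.Nat using (ℕ; zero; suc; _+_; _*_; _∸_; _^_; _≤_; _<_; _<ᵇ_; _!)

open import Data.Bool using (Bool; true; false; T; _∧_; if_then_else_)
open import Data.Fin using (Fin; toℕ)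
open import Data.Product using (Σ; _×_; ∃-syntax)
open import Relation.Binary.PropositionalEquality using (_≡_)

countF : {n : ℕ} → (Fin n → Bool) → ℕ
countF {zero} f = 0
countF {suc n} f = (if f Fin.zero then 1 else 0) + countF (λ i → f (Fin.suc i))

sumF : {n : ℕ} → (Fin n → ℕ) → ℕ
sumF {zero} f = 0
sumF {suc n} f = f Fin.zero + sumF (λ i → f (Fin.suc i))

record Graph (n : ℕ) : Set where
  field
    adj    : Fin n → Fin n → Bool
    sym    : ∀ u v → adj u v ≡ adj v u
    irrefl : ∀ v → adj v v ≡ false
open Graph public

edges : {n : ℕ} → Graph n → ℕ
edges G = sumF (λ i → countF (λ j → (toℕ i <ᵇ toℕ j) ∧ adj G i j))

record Subgraph {n : ℕ} (G : Graph n) : Set where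
  field
    vert     : Fin n → Bool
    edge     : Fin n → Fin n → Bool
    edge-sym : ∀ u v → edge u v ≡ edge v u
    edge-adj : ∀ u v → T (edge u v) → T (adj G u v)
    edge-vl  : ∀ u v → T (edge u v) → T (vert u)
    edge-vr  : ∀ u v → T (edge u v) → T (vert v)
open Subgraph public

nVert : {n : ℕ} {G : Graph n} → Subgraph G → ℕ
nVert H = countF (vert H)

degH : {n : ℕ} {G : Graph n} → Subgraph G → Fin n → ℕ
degH H v = countF (edge H v)

MinDegGe : {n : ℕ} {G : Graph n} → Subgraph G → ℕ → Set
MinDegGe H d = ∀ v → T (vert H v) → d ≤ degH H v

data WalkLe {n : ℕ} (E : Fin n → Fin n → Bool) : ℕ → Fin n → Fin n → Set where
  here : ∀ {k u} → WalkLe E k u u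
  step : ∀ {k u w v} → T (E u w) → WalkLe E k w v → WalkLe E (suc k) u v

RadLe : {n : ℕ} {G : Graph n} → Subgraph G → ℕ → Set
RadLe H r = Σ _ λ c → T (vert H c) × (∀ v → T (vert H v) → WalkLe (edge H) r c v)

-- expS a b N = b^N · N! · Σ_{k=0}^{N} (a/b)^k / k!
expS : ℕ → ℕ → ℕ → ℕ
expS a b zero = 1
expS a b (suc N) = suc N * b * expS a b N + a ^ suc N

-- The condition n^{t/r} > 6t·ln(2nr), expressed without reals:
-- there is a rational q = a/b ≥ 0 with q < n^{t/r}/(6t) (i.e. (6ta)^r < n^t b^r)
-- and e^q > 2nr (witnessed by a partial sum of the exponential series).
LogCond : ℕ → ℕ → ℕ → Set
LogCond n t r =
  ∃[ a ] ∃[ b ] ∃[ N ]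
    (0 < b)
    × ((6 * t * a) ^ r < n ^ t * b ^ r)
    × (2 * n * r * b ^ N * (N !) < expS a b N)

module Submission where

-- Count ordered t-tuples of vertices, joined when completely adjacent. Two applications of the
-- power mean inequality produce so many copies of K_{t,t} that, after pruning, there remains a
-- nonempty family of tuples, each joined to q pairwise disjoint members avoiding any prescribed t
-- vertices, where q > (2t)^t n^{t/r}. This gives a q-ary branching structure of t-blocks in which
-- two blocks at distance two along a path are disjoint. Of the q^r paths of length r from a root,
-- more than (2t)^{tr} end at one of the at most n^t possible blocks; if the penultimate blocks of
-- the paths to a block B always covered fewer than 2t vertices, each step would multiply the
-- number of paths to a block by at most (2t)^t. So there are at most t + 1 paths, of equal length
-- at most r and with a common end B, whose penultimate blocks cover 2t vertices. After deleting
-- the common prefix, their union induces G*: an inner block sees its predecessor and its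
-- successor, the root block two disjoint children, and B the penultimate blocks.

open import Defs
import Algebra.Properties.CommutativeSemigroup as CommutativeSemigroup
open import Data.Bool using (Bool; true; false; T; _∧_; if_then_else_)
open import Data.Bool.Properties using (T-∧; ∧-comm)
open import Data.Empty using (⊥; ⊥-elim)
open import Data.Fin using (Fin; toℕ)
open import Data.Fin.Properties using () renaming (_≟_ to _≟F_; any? to any?F)
open import Data.List using (List; []; _∷_; _++_; map; concatMap; allFin; length; [_])
open import Data.List.Properties using (map-++; map-∘; map-cong; map-tabulate; ≡-dec; length-tabulate; length-++)
open import Data.List.Membership.Propositional using (_∈_; _∉_; find)
open import Data.List.Membership.Propositional.Properties using (∈-map⁺; ∈-map⁻; ∈-++⁺ˡ; ∈-++⁺ʳ; ∈-++⁻; ∈-concatMap⁺; ∈-concatMap⁻; ∈-allFin)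
open import Data.List.Relation.Binary.Disjoint.Propositional using (Disjoint)
open import Data.List.Relation.Binary.Sublist.Propositional as Sublist using (_⊆_; []; _∷_; _∷ʳ_; ⊆-refl; ⊆-trans)
open import Data.List.Relation.Unary.All as All using (All; []; _∷_)
open import Data.List.Relation.Unary.All.Properties using (¬Any⇒All¬; ¬All⇒Any¬)
open import Data.List.Relation.Unary.AllPairs using ([]; _∷_)
open import Data.List.Relation.Unary.Any as Any using (Any; here; there; any?; _─_)
open import Data.List.Relation.Unary.Unique.Propositional using (Unique)
open import Data.List.Relation.Unary.Unique.Propositional.Properties using (allFin⁺; ++⁺; map⁺)
open import Data.Nat using (ℕ; zero; suc; _+_; _*_; _∸_; _^_; _≤_; _<_; z≤n; s≤s; NonZero; _≤?_; _<?_; _<ᵇ_; >-nonZero)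
open import Data.Nat.ListAction using (sum; product)
open import Data.Nat.ListAction.Properties using (sum-++)
open import Data.Nat.Properties
open import Data.Nat.Tactic.RingSolver using (solve-∀)
open import Data.Product using (Σ; _×_; _,_; proj₁; proj₂; ∃-syntax)
open import Data.Sum using (_⊎_; inj₁; inj₂)
open import Function using (_∘_; id)
open import Function.Bundles using (Equivalence)
open import Relation.Binary.Definitions using (DecidableEquality)
open import Relation.Binary.PropositionalEquality using (_≡_; _≢_; refl; cong; cong₂; subst; subst₂; trans; module ≡-Reasoning) renaming (sym to ≡-sym)
open import Relation.Nullary using (Dec; yes; no; does; contradiction; ¬?)
open import Relation.Nullary.Decidable using (_×-dec_; ⌊_⌋; toWitness; fromWitness)

open CommutativeSemigroup +-commutativeSemigroup using () renaming (interchange to +-interchange; x∙yz≈y∙xz to +-left-comm)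
open CommutativeSemigroup *-commutativeSemigroup using () renaming (interchange to *-interchange; x∙yz≈y∙xz to *-left-comm; x∙yz≈xz∙y to *-right-comm; x∙yz≈yx∙z to *-left-comm-assoc)

private
  variable
    A B : Set

-- Sums and products over lists

∑ : List A → (A → ℕ) → ℕ
∑ L f = sum (map f L)

∏ : List A → (A → ℕ) → ℕ
∏ L f = product (map f L)

∑-cong : (L : List A) {f g : A → ℕ} → (∀ x → f x ≡ g x) → ∑ L f ≡ ∑ L g
∑-cong L f≡g = cong sum (map-cong f≡g L)

∑-mono-∈ : (L : List A) {f g : A → ℕ} → (∀ {x} → x ∈ L → f x ≤ g x) → ∑ L f ≤ ∑ L g
∑-mono-∈ []      f≤g = z≤n
∑-mono-∈ (x ∷ L) f≤g = +-mono-≤ (f≤g (here refl)) (∑-mono-∈ L (f≤g ∘ there))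

∑-mono : (L : List A) {f g : A → ℕ} → (∀ x → f x ≤ g x) → ∑ L f ≤ ∑ L g
∑-mono L f≤g = ∑-mono-∈ L (λ {x} _ → f≤g x)

∑-+ : (L : List A) (f g : A → ℕ) → ∑ L (λ x → f x + g x) ≡ ∑ L f + ∑ L g
∑-+ []      f g = refl
∑-+ (x ∷ L) f g = trans (cong (f x + g x +_) (∑-+ L f g)) (+-interchange (f x) (g x) (∑ L f) (∑ L g))

∑-*ˡ : (L : List A) (c : ℕ) (f : A → ℕ) → ∑ L (λ x → c * f x) ≡ c * ∑ L f
∑-*ˡ []      c f = ≡-sym (*-zeroʳ c)
∑-*ˡ (x ∷ L) c f = trans (cong (c * f x +_) (∑-*ˡ L c f)) (≡-sym (*-distribˡ-+ c (f x) (∑ L f)))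

∑-*ʳ : (L : List A) (c : ℕ) (f : A → ℕ) → ∑ L (λ x → f x * c) ≡ ∑ L f * c
∑-*ʳ L c f = trans (∑-cong L (λ x → *-comm (f x) c)) (trans (∑-*ˡ L c f) (*-comm c (∑ L f)))

∑-const : (L : List A) (c : ℕ) → ∑ L (λ _ → c) ≡ length L * c
∑-const []      c = refl
∑-const (x ∷ L) c = cong (c +_) (∑-const L c)

∑-1 : (L : List A) → ∑ L (λ _ → 1) ≡ length L
∑-1 L = trans (∑-const L 1) (*-identityʳ (length L))

∑-swap : (L : List A) (M : List B) (f : A → B → ℕ) →
         ∑ L (λ x → ∑ M (f x)) ≡ ∑ M (λ y → ∑ L (λ x → f x y))
∑-swap []      M f = ≡-sym (trans (∑-const M 0) (*-zeroʳ (length M)))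
∑-swap (x ∷ L) M f = trans (cong (∑ M (f x) +_) (∑-swap L M f)) (≡-sym (∑-+ M (f x) _))

∑-++ : (L M : List A) (f : A → ℕ) → ∑ (L ++ M) f ≡ ∑ L f + ∑ M f
∑-++ L M f = trans (cong sum (map-++ f L M)) (sum-++ (map f L) (map f M))

∑-map : (L : List A) (h : A → B) (f : B → ℕ) → ∑ (map h L) f ≡ ∑ L (f ∘ h)
∑-map L h f = cong sum (≡-sym (map-∘ L))

∑-concatMap : (L : List A) (h : A → List B) (f : B → ℕ) →
              ∑ (concatMap h L) f ≡ ∑ L (λ x → ∑ (h x) f)
∑-concatMap []      h f = refl
∑-concatMap (x ∷ L) h f = trans (∑-++ (h x) (concatMap h L) f) (cong (∑ (h x) f +_) (∑-concatMap L h f))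

∑-⊆ : {L M : List A} (f : A → ℕ) → L ⊆ M → ∑ L f ≤ ∑ M f
∑-⊆ f []           = z≤n
∑-⊆ f (y ∷ʳ L⊆M)   = ≤-trans (∑-⊆ f L⊆M) (m≤n+m _ (f y))
∑-⊆ f (refl ∷ L⊆M) = +-monoʳ-≤ _ (∑-⊆ f L⊆M)

∈⇒≤∑ : {L : List A} {x : A} (f : A → ℕ) → x ∈ L → f x ≤ ∑ L f
∈⇒≤∑ f (here refl) = m≤m+n _ _
∈⇒≤∑ f (there x∈L) = ≤-trans (∈⇒≤∑ f x∈L) (m≤n+m _ _)

∏-≤1 : (L : List A) (f : A → ℕ) → (∀ x → f x ≤ 1) → ∏ L f ≤ 1
∏-≤1 []      f f≤1 = ≤-refl
∏-≤1 (x ∷ L) f f≤1 = *-mono-≤ (f≤1 x) (∏-≤1 L f f≤1)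

∏-∈ : {L : List A} {x : A} (f : A → ℕ) → x ∈ L → f x ≡ 0 → ∏ L f ≡ 0
∏-∈ {L = x ∷ L} f (here refl) fx≡0 = cong (_* ∏ L f) fx≡0
∏-∈ {L = y ∷ L} f (there x∈L) fx≡0 = trans (cong (f y *_) (∏-∈ f x∈L fx≡0)) (*-zeroʳ (f y))

∏-* : (L : List A) (f g : A → ℕ) → ∏ L (λ x → f x * g x) ≡ ∏ L f * ∏ L g
∏-* []      f g = refl
∏-* (x ∷ L) f g = trans (cong (f x * g x *_) (∏-* L f g)) (*-interchange (f x) (g x) (∏ L f) (∏ L g))

∏-cong : (L : List A) {f g : A → ℕ} → (∀ x → f x ≡ g x) → ∏ L f ≡ ∏ L g
∏-cong L f≡g = cong product (map-cong f≡g L)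

∏-unit : (L : List A) → ∏ L (λ _ → 1) ≡ 1
∏-unit []      = refl
∏-unit (x ∷ L) = trans (+-identityʳ _) (∏-unit L)

∏-swap : (L : List A) (M : List B) (f : A → B → ℕ) →
         ∏ L (λ x → ∏ M (f x)) ≡ ∏ M (λ y → ∏ L (λ x → f x y))
∏-swap []      M f = ≡-sym (∏-unit M)
∏-swap (x ∷ L) M f = trans (cong (∏ M (f x) *_) (∏-swap L M f)) (≡-sym (∏-* M (f x) _))

^-distribʳ-* : ∀ k a b → (a * b) ^ k ≡ a ^ k * b ^ k
^-distribʳ-* zero    a b = refl
^-distribʳ-* (suc k) a b = trans (cong (a * b *_) (^-distribʳ-* k a b)) (*-interchange a b (a ^ k) (b ^ k))

^-cancelˡ-≤ : ∀ k {a b} → 0 < k → a ^ k ≤ b ^ k → a ≤ b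
^-cancelˡ-≤ k@(suc _) {a} {b} 0<k aᵏ≤bᵏ with a ≤? b
... | yes a≤b = a≤b
... | no  a≰b = contradiction aᵏ≤bᵏ (<⇒≱ (^-monoˡ-< k (≰⇒> a≰b)))

-- The power mean inequality

rearrangement : ∀ {a b c d} → a ≤ b → c ≤ d → a * d + b * c ≤ a * c + b * d
rearrangement {a} {b} {c} {d} a≤b c≤d with m≤n⇒∃[o]m+o≡n a≤b | m≤n⇒∃[o]m+o≡n c≤d
... | x , refl | y , refl = subst (a * (c + y) + (a + x) * c ≤_) (≡-sym (expand a c x y)) (m≤m+n _ (x * y))
  where
  expand : ∀ a c x y → a * c + (a + x) * (c + y) ≡ a * (c + y) + (a + x) * c + x * y
  expand = solve-∀

module _ (L : List A) (f : A → ℕ) where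
  private
    cross : ∀ k x y → f x * f y ^ k + f y * f x ^ k ≤ f x * f x ^ k + f y * f y ^ k
    cross k x y with ≤-total (f x) (f y)
    ... | inj₁ fx≤fy = rearrangement fx≤fy (^-monoˡ-≤ k fx≤fy)
    ... | inj₂ fy≤fx = subst₂ _≤_ (+-comm (f y * f x ^ k) _) (+-comm (f y * f y ^ k) _)
                         (rearrangement fy≤fx (^-monoˡ-≤ k fy≤fx))

  -- Chebyshev's sum inequality for the similarly ordered `f` and `f ^ k`: add `cross` over all
  -- ordered pairs. Each product of sums then occurs twice, hence the factor 2 that is cancelled.
  chebyshev : ∀ k → ∑ L f * ∑ L (λ x → f x ^ k) ≤ length L * ∑ L (λ x → f x ^ suc k)
  chebyshev k = *-cancelˡ-≤ 2 (begin
    2 * (∑ L f * ∑ L g)                                        ≡⟨ twice (∑ L f * ∑ L g) ⟩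
    ∑ L f * ∑ L g + ∑ L f * ∑ L g                              ≡⟨ cong₂ _+_ fg gf ⟩
    ∑ L (λ x → ∑ L (λ y → f x * g y)) + ∑ L (λ x → ∑ L (λ y → f y * g x))
                                                               ≡⟨ ≡-sym (∑∑-+ _ _) ⟩
    ∑ L (λ x → ∑ L (λ y → f x * g y + f y * g x))              ≤⟨ ∑-mono L (λ x → ∑-mono L (cross k x)) ⟩
    ∑ L (λ x → ∑ L (λ y → f x * g x + f y * g y))              ≡⟨ ∑∑-+ _ _ ⟩
    ∑ L (λ x → ∑ L (λ y → f x * g x)) + ∑ L (λ x → ∑ L (λ y → f y * g y))
      ≡⟨ cong₂ _+_ (trans (∑-cong L (λ x → ∑-const L _)) (∑-*ˡ L (length L) _)) (∑-const L _) ⟩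
    length L * ∑ L h + length L * ∑ L h                        ≡⟨ ≡-sym (twice (length L * ∑ L h)) ⟩
    2 * (length L * ∑ L h)                                     ∎)
    where
    open ≤-Reasoning
    g h : A → ℕ
    g x = f x ^ k
    h x = f x * g x
    twice : ∀ a → 2 * a ≡ a + a
    twice = solve-∀
    ∑∑-+ : (p q : A → A → ℕ) → ∑ L (λ x → ∑ L (λ y → p x y + q x y)) ≡ ∑ L (λ x → ∑ L (p x)) + ∑ L (λ x → ∑ L (q x))
    ∑∑-+ p q = trans (∑-cong L (λ x → ∑-+ L (p x) (q x))) (∑-+ L _ _)
    fg : ∑ L f * ∑ L g ≡ ∑ L (λ x → ∑ L (λ y → f x * g y))
    fg = ≡-sym (trans (∑-cong L (λ x → ∑-*ˡ L (f x) g)) (∑-*ʳ L (∑ L g) f))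
    gf : ∑ L f * ∑ L g ≡ ∑ L (λ x → ∑ L (λ y → f y * g x))
    gf = ≡-sym (trans (∑-cong L (λ x → ∑-*ʳ L (g x) f)) (∑-*ˡ L (∑ L f) g))

  -- Multiplying the usual form by `length L` avoids the exponent `k - 1`, so the induction starts
  -- at 0 and needs only `chebyshev`.
  power-mean : ∀ k → ∑ L f ^ k * length L ≤ length L ^ k * ∑ L (λ x → f x ^ k)
  power-mean zero    = ≤-reflexive (cong (1 *_) (≡-sym (∑-1 L)))
  power-mean (suc k) = begin
    ∑ L f * ∑ L f ^ k * length L                          ≡⟨ *-assoc (∑ L f) _ _ ⟩
    ∑ L f * (∑ L f ^ k * length L)                        ≤⟨ *-monoʳ-≤ (∑ L f) (power-mean k) ⟩
    ∑ L f * (length L ^ k * ∑ L (λ x → f x ^ k))          ≡⟨ *-left-comm (∑ L f) (length L ^ k) _ ⟩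
    length L ^ k * (∑ L f * ∑ L (λ x → f x ^ k))          ≤⟨ *-monoʳ-≤ (length L ^ k) (chebyshev k) ⟩
    length L ^ k * (length L * ∑ L (λ x → f x ^ suc k))   ≡⟨ *-left-comm-assoc (length L ^ k) (length L) _ ⟩
    length L * length L ^ k * ∑ L (λ x → f x ^ suc k)     ∎
    where
    open ≤-Reasoning

-- Repetitions are allowed, which makes sums over tuples factor into powers; distinct entries are
-- recovered later through `coincidences`.
tuples : List A → ℕ → List (List A)
tuples L zero    = [ [] ]
tuples L (suc t) = concatMap (λ x → map (x ∷_) (tuples L t)) L

∑-tuples-suc : (L : List A) (t : ℕ) (f : List A → ℕ) →
               ∑ (tuples L (suc t)) f ≡ ∑ L (λ x → ∑ (tuples L t) (λ S → f (x ∷ S)))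
∑-tuples-suc L t f = trans (∑-concatMap L _ f) (∑-cong L (λ x → ∑-map (tuples L t) (x ∷_) f))

-- Expansion of the power of a sum. For a 0/1-valued `f` it counts the tuples inside the support,
-- which is how stars and copies of K_{t,t} are counted.
∑-tuples-∏ : (L : List A) (t : ℕ) (f : A → ℕ) → ∑ (tuples L t) (λ S → ∏ S f) ≡ ∑ L f ^ t
∑-tuples-∏ L zero    f = refl
∑-tuples-∏ L (suc t) f = begin
  ∑ (tuples L (suc t)) (λ S → ∏ S f)                 ≡⟨ ∑-tuples-suc L t _ ⟩
  ∑ L (λ x → ∑ (tuples L t) (λ S → f x * ∏ S f))     ≡⟨ ∑-cong L (λ x → trans (∑-*ˡ (tuples L t) (f x) _) (cong (f x *_) (∑-tuples-∏ L t f))) ⟩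
  ∑ L (λ x → f x * ∑ L f ^ t)                        ≡⟨ ∑-*ʳ L (∑ L f ^ t) f ⟩
  ∑ L f * ∑ L f ^ t                                  ∎
  where open ≡-Reasoning

length-tuples : (L : List A) (t : ℕ) → length (tuples L t) ≡ length L ^ t
length-tuples L t = begin
  length (tuples L t)                     ≡⟨ ≡-sym (∑-1 (tuples L t)) ⟩
  ∑ (tuples L t) (λ _ → 1)                ≡⟨ ∑-cong (tuples L t) (λ S → ≡-sym (∏-unit S)) ⟩
  ∑ (tuples L t) (λ S → ∏ S (λ _ → 1))    ≡⟨ ∑-tuples-∏ L t _ ⟩
  ∑ L (λ _ → 1) ^ t                       ≡⟨ cong (_^ t) (∑-1 L) ⟩
  length L ^ t                            ∎
  where open ≡-Reasoning

∈-tuples⁺ : (L : List A) (S : List A) → (∀ {x} → x ∈ S → x ∈ L) → S ∈ tuples L (length S)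
∈-tuples⁺ L []      S⊆L = here refl
∈-tuples⁺ L (x ∷ S) S⊆L =
  ∈-concatMap⁺ (λ y → map (y ∷_) (tuples L (length S)))
    (Any.map (λ { refl → ∈-map⁺ (x ∷_) (∈-tuples⁺ L S (S⊆L ∘ there)) }) (S⊆L (here refl)))

∈-tuples⁻ : (L : List A) (t : ℕ) {S : List A} → S ∈ tuples L t → length S ≡ t
∈-tuples⁻ L zero    (here refl) = refl
∈-tuples⁻ L (suc t) S∈ with Any.satisfied (∈-concatMap⁻ (λ y → map (y ∷_) (tuples L t)) {xs = L} S∈)
... | y , S∈map with ∈-map⁻ (y ∷_) S∈map
... | S′ , S′∈ , refl = cong suc (∈-tuples⁻ L t S′∈)

-- Coincidences and pruning

bit : Bool → ℕ
bit b = if b then 1 else 0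

bit≤1 : ∀ b → bit b ≤ 1
bit≤1 true  = ≤-refl
bit≤1 false = z≤n

module Coincidences {A : Set} (_≟_ : DecidableEquality A) where

  δ : A → A → ℕ
  δ x y = bit (does (x ≟ y))

  δ-refl : ∀ x → δ x x ≡ 1
  δ-refl x with x ≟ x
  ... | yes _   = refl
  ... | no x≢x = contradiction refl x≢x

  δ-≢ : ∀ {x y} → x ≢ y → δ x y ≡ 0
  δ-≢ {x} {y} x≢y with x ≟ y
  ... | yes x≡y = contradiction x≡y x≢y
  ... | no  _   = refl

  δ-sym : ∀ x y → δ x y ≡ δ y x
  δ-sym x y with x ≟ y
  ... | yes refl = ≡-sym (δ-refl x)
  ... | no  x≢y  = ≡-sym (δ-≢ (x≢y ∘ ≡-sym))

  ∑-δ-∈ : {L : List A} {y : A} → y ∈ L → 1 ≤ ∑ L (λ x → δ x y)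
  ∑-δ-∈ {y = y} y∈L = ≤-trans (≤-reflexive (≡-sym (δ-refl y))) (∈⇒≤∑ (λ x → δ x y) y∈L)

  ∑-δ-∉ : (L : List A) {y : A} → y ∉ L → ∑ L (λ x → δ x y) ≡ 0
  ∑-δ-∉ []      y∉L = refl
  ∑-δ-∉ (x ∷ L) y∉L = cong₂ _+_ (δ-≢ (λ { refl → y∉L (here refl) })) (∑-δ-∉ L (y∉L ∘ there))

  ∑-δ-unique : {L : List A} → Unique L → ∀ y → ∑ L (λ x → δ x y) ≤ 1
  ∑-δ-unique []              y = z≤n
  ∑-δ-unique {L = x ∷ L} (x∉L ∷ uniq) y with x ≟ y
  ... | yes refl = ≤-reflexive (cong suc (∑-δ-∉ L (λ x∈L → All.lookup x∉L x∈L refl)))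
  ... | no  _    = ∑-δ-unique uniq y

  -- Insert `δ x y` and exchange the sums: each `y` of `M` is charged by at most one `x`, as `L` has
  -- no repetitions.
  ∑-unique-≤ : {L M : List A} → Unique L → (f : A → ℕ) → (∀ {x} → x ∈ L → x ∈ M) →
               ∑ L f ≤ ∑ M f
  ∑-unique-≤ {L} {M} uniq f L⊆M = begin
    ∑ L f                                  ≤⟨ ∑-mono-∈ L (λ {x} x∈L → ≤-trans (≤-reflexive (at x)) (∈⇒≤∑ (λ y → f y * δ x y) (L⊆M x∈L))) ⟩
    ∑ L (λ x → ∑ M (λ y → f y * δ x y))    ≡⟨ ∑-swap L M _ ⟩
    ∑ M (λ y → ∑ L (λ x → f y * δ x y))    ≤⟨ ∑-mono M (λ y → ≤-trans (≤-reflexive (∑-*ˡ L (f y) _)) (*-monoʳ-≤ (f y) (∑-δ-unique uniq y))) ⟩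
    ∑ M (λ y → f y * 1)                    ≡⟨ ∑-cong M (λ y → *-identityʳ (f y)) ⟩
    ∑ M f                                  ∎
    where
    open ≤-Reasoning
    at : ∀ x → f x ≡ f x * δ x x
    at x = ≡-sym (trans (cong (f x *_) (δ-refl x)) (*-identityʳ (f x)))

  unique-length-≤ : {L M : List A} → Unique L → (∀ {x} → x ∈ L → x ∈ M) → length L ≤ length M
  unique-length-≤ {L} {M} uniq L⊆M =
    ≤-trans (≤-reflexive (≡-sym (∑-1 L))) (≤-trans (∑-unique-≤ uniq (λ _ → 1) L⊆M) (≤-reflexive (∑-1 M)))

  -- Vanishes exactly when S has distinct entries and avoids Y; as a sum of δ's it is linear to count.
  coincidences : List A → List A → ℕ
  coincidences Y []      = 0
  coincidences Y (x ∷ S) = ∑ Y (λ y → δ y x) + coincidences (x ∷ Y) S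

  fresh-avoids : ∀ Y S → coincidences Y S ≡ 0 → ∀ {x} → x ∈ S → x ∉ Y
  fresh-avoids Y (x ∷ S) fresh (here refl) x∈Y =
    contradiction (m+n≡0⇒m≡0 _ fresh) (>⇒≢ (∑-δ-∈ x∈Y))
  fresh-avoids Y (x ∷ S) fresh (there z∈S) z∈Y =
    fresh-avoids (x ∷ Y) S (m+n≡0⇒n≡0 (∑ Y (λ y → δ y x)) fresh) z∈S (there z∈Y)

  fresh-unique : ∀ Y S → coincidences Y S ≡ 0 → Unique S
  fresh-unique Y []      fresh = []
  fresh-unique Y (x ∷ S) fresh =
    All.tabulate (λ { z∈S refl → fresh-avoids (x ∷ Y) S fresh′ z∈S (here refl) }) ∷ fresh-unique (x ∷ Y) S fresh′
    where fresh′ = m+n≡0⇒n≡0 (∑ Y (λ y → δ y x)) fresh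

  -- Multiplied by M = ∑ L g, so that the power t − 1 of M does not occur.
  ∑-coincidences : {L : List A} → Unique L → (g : A → ℕ) → (∀ x → g x ≤ 1) → ∀ t Y →
    ∑ (tuples L t) (λ S → ∏ S g * coincidences Y S) * ∑ L g ≤ t * (length Y + t) * ∑ L g ^ t
  ∑-coincidences uniq g g≤1 zero    Y = z≤n
  ∑-coincidences {L} uniq g g≤1 (suc t) Y = begin
    ∑ (tuples L (suc t)) (λ S → ∏ S g * coincidences Y S) * M
      ≡⟨ cong (_* M) (trans (∑-tuples-suc L t _) (trans (∑-cong L split) (∑-+ L _ _))) ⟩
    (∑ L (λ x → g x * hit x * M ^ t) + ∑ L (λ x → g x * later x)) * M
      ≡⟨ trans (*-distribʳ-+ M (∑ L (λ x → g x * hit x * M ^ t)) _) (cong₂ _+_ (cong (_* M) (∑-*ʳ L (M ^ t) _)) (≡-sym (∑-*ʳ L M _))) ⟩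
    ∑ L (λ x → g x * hit x) * M ^ t * M + ∑ L (λ x → g x * later x * M)
      ≤⟨ +-mono-≤ (*-monoˡ-≤ M (*-monoˡ-≤ (M ^ t) hits)) (∑-mono L laters) ⟩
    y * M ^ t * M + ∑ L (λ x → g x * (t * (suc y + t) * M ^ t))
      ≡⟨ cong (y * M ^ t * M +_) (∑-*ʳ L _ g) ⟩
    y * M ^ t * M + M * (t * (suc y + t) * M ^ t)
      -- Slack: `y + t * (suc y + t)` falls short of `suc t * (y + suc t)` by exactly `suc t`.
      ≤⟨ m≤m+n _ (M * M ^ t * suc t) ⟩
    y * M ^ t * M + M * (t * (suc y + t) * M ^ t) + M * M ^ t * suc t
      ≡⟨ arith y M t (M ^ t) ⟩
    suc t * (y + suc t) * (M * M ^ t) ∎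
    where
    open ≤-Reasoning
    M y : ℕ
    M = ∑ L g
    y = length Y
    hit later : A → ℕ
    hit x = ∑ Y (λ z → δ z x)
    later x = ∑ (tuples L t) (λ S → ∏ S g * coincidences (x ∷ Y) S)
    arith : ∀ y M t P → y * P * M + M * (t * (suc y + t) * P) + M * P * suc t ≡ suc t * (y + suc t) * (M * P)
    arith = solve-∀
    distribute : ∀ a b c d → a * b * (c + d) ≡ a * c * b + a * (b * d)
    distribute = solve-∀
    split : ∀ x → ∑ (tuples L t) (λ S → g x * ∏ S g * (hit x + coincidences (x ∷ Y) S))
                  ≡ g x * hit x * M ^ t + g x * later x
    split x =
      trans (∑-cong (tuples L t) (λ S → distribute (g x) (∏ S g) (hit x) _))
        (trans (∑-+ (tuples L t) _ _)
          (cong₂ _+_ (trans (∑-*ˡ (tuples L t) (g x * hit x) _) (cong (g x * hit x *_) (∑-tuples-∏ L t g)))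
                     (∑-*ˡ (tuples L t) (g x) _)))
    -- Each `z` of `Y` equals at most one `x` of `L`, whose entries are distinct.
    hits : ∑ L (λ x → g x * hit x) ≤ y
    hits = begin
      ∑ L (λ x → g x * hit x)           ≤⟨ ∑-mono L (λ x → ≤-trans (*-monoˡ-≤ (hit x) (g≤1 x)) (≤-reflexive (*-identityˡ (hit x)))) ⟩
      ∑ L hit                           ≡⟨ ∑-swap L Y _ ⟩
      ∑ Y (λ z → ∑ L (δ z))             ≡⟨ ∑-cong Y (λ z → ∑-cong L (λ x → δ-sym z x)) ⟩
      ∑ Y (λ z → ∑ L (λ x → δ x z))     ≤⟨ ∑-mono Y (∑-δ-unique uniq) ⟩
      ∑ Y (λ _ → 1)                     ≡⟨ ∑-1 Y ⟩
      y ∎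
    laters : ∀ x → g x * later x * M ≤ g x * (t * (suc y + t) * M ^ t)
    laters x = ≤-trans (≤-reflexive (*-assoc (g x) (later x) M))
                       (*-monoʳ-≤ (g x) (∑-coincidences uniq g g≤1 t (x ∷ Y)))

module _ {A : Set} where

  ∑-remove : {L : List A} {x : A} (x∈L : x ∈ L) (f : A → ℕ) → ∑ L f ≡ f x + ∑ (L ─ x∈L) f
  ∑-remove (here refl) f = refl
  ∑-remove {L = y ∷ L} {x} (there x∈L) f =
    trans (cong (f y +_) (∑-remove x∈L f)) (+-left-comm (f y) (f x) _)

  ─-⊆ : {L : List A} {x : A} (x∈L : x ∈ L) → (L ─ x∈L) ⊆ L
  ─-⊆ (here {x = y} px) = y ∷ʳ ⊆-refl
  ─-⊆ (there x∈L)       = refl ∷ ─-⊆ x∈L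

  -- Deleting a vertex x with 2 · deg x < w x keeps ∑ w < ∑ deg, which forces the list to stay nonempty.
  prune : (w : A → ℕ) (R : A → A → ℕ) → (∀ x y → R x y ≡ R y x) →
          (L : List A) → ∑ L w < ∑ L (λ x → ∑ L (R x)) →
          ∃[ L′ ] L′ ⊆ L × (∀ {x} → x ∈ L′ → w x ≤ 2 * ∑ L′ (R x)) × ∃[ x ] x ∈ L′
  prune w R R-sym L dense = go (∑ L (λ _ → 1)) L refl dense
    where
    go : ∀ k L → ∑ L (λ _ → 1) ≡ k → ∑ L w < ∑ L (λ x → ∑ L (R x)) →
         ∃[ L′ ] L′ ⊆ L × (∀ {x} → x ∈ L′ → w x ≤ 2 * ∑ L′ (R x)) × ∃[ x ] x ∈ L′
    go zero    []         size dense = contradiction dense λ ()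
    go (suc k) L@(x₀ ∷ _) size dense with any? (λ x → 2 * ∑ L (R x) <? w x) L
    ... | no  none = L , ⊆-refl , (λ x∈L → ≮⇒≥ (All.lookup (¬Any⇒All¬ L none) x∈L)) , x₀ , here refl
    ... | yes some with find some
    ...   | x , x∈L , light with go k (L ─ x∈L) (suc-injective (trans (≡-sym (∑-remove x∈L (λ _ → 1))) size)) dense′
      where
      L′ = L ─ x∈L
      -- Removing `x` loses its row and, by symmetry, its column: together at most `2 * ∑ L (R x)`,
      -- which is less than `w x`.
      degrees : ∑ L (λ y → ∑ L (R y)) ≡ ∑ L (R x) + (∑ L′ (R x) + ∑ L′ (λ y → ∑ L′ (R y)))
      degrees = trans (∑-remove x∈L (λ y → ∑ L (R y)))
        (cong (∑ L (R x) +_) (trans (∑-cong L′ (λ y → trans (∑-remove x∈L (R y)) (cong (_+ ∑ L′ (R y)) (R-sym y x))))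
                                    (∑-+ L′ (R x) _)))
      dense′ : ∑ L′ w < ∑ L′ (λ y → ∑ L′ (R y))
      dense′ = +-cancelˡ-< (w x) _ _ (begin-strict
        w x + ∑ L′ w                                     ≡⟨ ≡-sym (∑-remove x∈L w) ⟩
        ∑ L w                                            <⟨ dense ⟩
        ∑ L (λ y → ∑ L (R y))                            ≡⟨ degrees ⟩
        ∑ L (R x) + (∑ L′ (R x) + ∑ L′ (λ y → ∑ L′ (R y)))
          ≤⟨ +-monoʳ-≤ (∑ L (R x)) (+-monoˡ-≤ _ (∑-⊆ (R x) (─-⊆ x∈L))) ⟩
        ∑ L (R x) + (∑ L (R x) + ∑ L′ (λ y → ∑ L′ (R y))) ≡⟨ twice (∑ L (R x)) _ ⟩
        2 * ∑ L (R x) + ∑ L′ (λ y → ∑ L′ (R y))          ≤⟨ +-monoˡ-≤ _ (<⇒≤ light) ⟩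
        w x + ∑ L′ (λ y → ∑ L′ (R y))                    ∎)
        where
        open ≤-Reasoning
        twice : ∀ a b → a + (a + b) ≡ 2 * a + b
        twice = solve-∀
    ...     | L″ , L″⊆L′ , heavy , nonempty = L″ , ⊆-trans L″⊆L′ (─-⊆ x∈L) , heavy , nonempty

-- A branching structure from the number of copies of K_{t,t}

sumF-∑ : ∀ {n} (f : Fin n → ℕ) → sumF f ≡ ∑ (allFin n) f
sumF-∑ {zero}  f = refl
sumF-∑ {suc n} f = cong (f Fin.zero +_) (trans (sumF-∑ (f ∘ Fin.suc))
  (trans (≡-sym (∑-map (allFin n) Fin.suc f)) (cong (λ L → ∑ L f) (map-tabulate id Fin.suc))))

countF-∑ : ∀ {n} (f : Fin n → Bool) → countF f ≡ ∑ (allFin n) (bit ∘ f)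
countF-∑ {zero}  f = refl
countF-∑ {suc n} f = cong (bit (f Fin.zero) +_) (trans (countF-∑ (f ∘ Fin.suc))
  (trans (≡-sym (∑-map (allFin n) Fin.suc (bit ∘ f))) (cong (λ L → ∑ L (bit ∘ f)) (map-tabulate id Fin.suc))))

module _ {n : ℕ} where
  open Coincidences (_≟F_ {n}) public
  open import Data.List.Membership.DecPropositional (_≟F_ {n}) public using (_∈?_)

  Joined : Graph n → List (Fin n) → List (Fin n) → Set
  Joined G P Q = ∀ {u v} → u ∈ P → v ∈ Q → T (adj G u v)

-- A state may carry more than its block, because the choice of children will also depend on the
-- preceding block. Disjointness is demanded only among siblings and between the two neighbours of
-- an inner block on a path; blocks farther apart may overlap.
record Branching {n : ℕ} (G : Graph n) (t q : ℕ) : Set₁ where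
  field
    State        : Set
    block        : State → List (Fin n)
    next         : State → Fin q → State
    block-length : ∀ X → length (block X) ≡ t
    block-unique : ∀ X → Unique (block X)
    next-joined  : ∀ X i → Joined G (block X) (block (next X i))
    siblings     : ∀ X {i j} → i ≢ j → Disjoint (block (next X i)) (block (next X j))
    grandparent  : ∀ X i j → Disjoint (block X) (block (next (next X i) j))

-- Whichever of `m` and `M` is larger, `m * M ^ t` is at most `(M ^ t + m ^ t) * M`, hence at most
-- `4 * a * M` and so at most `4 * Z * M ^ t`. As `4 * Z < m`, only `M ^ t = 0` remains; but then
-- `a = 0`, against `0 < m ^ t`.
balance : ∀ {t m M Z a} → 0 < t → 4 * Z < m → M ^ t + m ^ t ≤ 4 * a → a ≤ M ^ t → a * M ≤ Z * M ^ t → ⊥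
balance {suc t} {m} {M} {Z} {a} 0<t 4Z<m lower a≤Mᵗ upper = absurd (M ^ suc t) refl
  where
  open ≤-Reasoning
  instance
    m≢0 : NonZero m
    m≢0 = >-nonZero (≤-<-trans z≤n 4Z<m)
  mixed : m * M ^ suc t ≤ (M ^ suc t + m ^ suc t) * M
  mixed with ≤-total m M
  ... | inj₁ m≤M = begin
    m * M ^ suc t                     ≤⟨ *-monoˡ-≤ (M ^ suc t) m≤M ⟩
    M * M ^ suc t                     ≡⟨ *-comm M _ ⟩
    M ^ suc t * M                     ≤⟨ *-monoˡ-≤ M (m≤m+n (M ^ suc t) (m ^ suc t)) ⟩
    (M ^ suc t + m ^ suc t) * M       ∎
  ... | inj₂ M≤m = begin
    m * (M * M ^ t)                   ≤⟨ *-monoʳ-≤ m (*-monoʳ-≤ M (^-monoˡ-≤ t M≤m)) ⟩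
    m * (M * m ^ t)                   ≡⟨ cong (m *_) (*-comm M _) ⟩
    m * (m ^ t * M)                   ≡⟨ ≡-sym (*-assoc m _ M) ⟩
    m ^ suc t * M                     ≤⟨ *-monoˡ-≤ M (m≤n+m (m ^ suc t) (M ^ suc t)) ⟩
    (M ^ suc t + m ^ suc t) * M       ∎
  squeezed : m * M ^ suc t ≤ 4 * Z * M ^ suc t
  squeezed = begin
    m * M ^ suc t                     ≤⟨ mixed ⟩
    (M ^ suc t + m ^ suc t) * M       ≤⟨ *-monoˡ-≤ M lower ⟩
    4 * a * M                         ≡⟨ *-assoc 4 a M ⟩
    4 * (a * M)                       ≤⟨ *-monoʳ-≤ 4 upper ⟩
    4 * (Z * M ^ suc t)               ≡⟨ ≡-sym (*-assoc 4 Z _) ⟩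
    4 * Z * M ^ suc t                 ∎
  absurd : ∀ p → M ^ suc t ≡ p → ⊥
  absurd (suc p) eq = <⇒≱ 4Z<m (*-cancelʳ-≤ m (4 * Z) (suc p) (subst (λ p → m * p ≤ 4 * Z * p) eq squeezed))
  absurd zero eq = <⇒≱ (m^n>0 m (suc t)) (begin
    m ^ suc t                         ≤⟨ m≤n+m _ _ ⟩
    M ^ suc t + m ^ suc t             ≤⟨ lower ⟩
    4 * a                             ≤⟨ *-monoʳ-≤ 4 a≤Mᵗ ⟩
    4 * M ^ suc t                     ≡⟨ cong (4 *_) eq ⟩
    0                                 ∎)

-- Counting stars and bicliques

module _ {n : ℕ} (G : Graph n) where

  private
    V : List (Fin n)
    V = allFin n

  link : List (Fin n) → Fin n → ℕ
  link P v = ∏ P (λ u → bit (adj G u v))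

  codeg : List (Fin n) → ℕ
  codeg P = ∑ V (link P)

  -- A product of 0/1 values, so that by `∑-tuples-∏` its sum over all `t`-tuples `Q` is
  -- `codeg P ^ t`.
  joins : List (Fin n) → List (Fin n) → ℕ
  joins P Q = ∏ Q (link P)

  deg : Fin n → ℕ
  deg v = ∑ V (λ u → bit (adj G u v))

  joins-sym : ∀ P Q → joins P Q ≡ joins Q P
  joins-sym P Q = trans (∏-swap Q P _) (∏-cong P (λ u → ∏-cong Q (λ v → cong bit (Graph.sym G u v))))

  joins-Joined : ∀ P Q → joins P Q ≢ 0 → Joined G P Q
  joins-Joined P Q PQ≢0 {u} {v} u∈P v∈Q with adj G u v in uv
  ... | true  = _
  ... | false = PQ≢0 (∏-∈ (link P) v∈Q (∏-∈ (λ u → bit (adj G u v)) u∈P (cong bit uv)))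

  edges≤∑deg : edges G ≤ ∑ V deg
  edges≤∑deg = begin
    edges G                                                        ≡⟨ trans (sumF-∑ (λ i → countF (ahead i))) (∑-cong V (λ i → countF-∑ (ahead i))) ⟩
    ∑ V (λ i → ∑ V (λ j → bit ((toℕ i <ᵇ toℕ j) ∧ adj G i j)))    ≤⟨ ∑-mono V (λ i → ∑-mono V (λ j → bit-∧ (toℕ i <ᵇ toℕ j) _)) ⟩
    ∑ V (λ i → ∑ V (λ j → bit (adj G i j)))                        ≡⟨ ∑-swap V V _ ⟩
    ∑ V deg                                                        ∎
    where
    open ≤-Reasoning
    ahead : Fin n → Fin n → Bool
    ahead i j = (toℕ i <ᵇ toℕ j) ∧ adj G i j
    bit-∧ : ∀ b c → bit (b ∧ c) ≤ bit c
    bit-∧ true  c = ≤-refl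
    bit-∧ false c = z≤n

  module _ (t : ℕ) where

    -- Both sides count stars with `t` ordered leaves, repetitions allowed: once by the leaves, once
    -- by the centre.
    ∑codeg : ∑ (tuples V t) codeg ≡ ∑ V (λ v → deg v ^ t)
    ∑codeg = trans (∑-swap (tuples V t) V link) (∑-cong V (λ v → ∑-tuples-∏ V t _))

    length-V : length V ≡ n
    length-V = length-tabulate id

    stars-bound : ∑ V deg ^ t * n ≤ n ^ t * ∑ (tuples V t) codeg
    stars-bound = subst (λ k → ∑ V deg ^ t * k ≤ k ^ t * ∑ (tuples V t) codeg) length-V
      (subst (λ s → ∑ V deg ^ t * length V ≤ length V ^ t * s) (≡-sym ∑codeg) (power-mean V deg t))

    bicliques-bound : ∑ (tuples V t) codeg ^ t * n ^ t ≤ (n ^ t) ^ t * ∑ (tuples V t) (λ P → codeg P ^ t)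
    bicliques-bound = subst (λ k → s ^ t * k ≤ k ^ t * ∑ (tuples V t) (λ P → codeg P ^ t))
      (trans (length-tuples V t) (cong (_^ t) length-V)) (power-mean (tuples V t) codeg t)
      where s = ∑ (tuples V t) codeg

    -- Pruning the tuples and choosing children

    module _ (q m : ℕ) (0<t : 0 < t) (m-large : 4 * (t * (t + q * t + t)) < m)
             (dense : n ^ t * m ^ t < ∑ (tuples V t) (λ P → codeg P ^ t)) where

      private
        -- In all, `P` is joined to `codeg P ^ t` tuples. A `P` that survives pruning with this
        -- weight against `2 * joins` keeps at least a quarter of them, and at least `m ^ t / 4`
        -- even if `codeg P` is small. The factor 2 lets `dense` pay for the added terms, whose
        -- total is `n ^ t * m ^ t`.
        weight : List (Fin n) → ℕ
        weight P = codeg P ^ t + m ^ t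

        dense′ : ∑ (tuples V t) weight < ∑ (tuples V t) (λ P → ∑ (tuples V t) (λ Q → 2 * joins P Q))
        dense′ = begin-strict
          ∑ 𝓣 weight                             ≡⟨ trans (∑-+ 𝓣 _ _) (cong (W +_) (trans (∑-const 𝓣 (m ^ t)) (cong (_* m ^ t) (trans (length-tuples V t) (cong (_^ t) length-V))))) ⟩
          W + n ^ t * m ^ t                      <⟨ +-monoʳ-< W dense ⟩
          W + W                                  ≡⟨ cong (W +_) (≡-sym (+-identityʳ W)) ⟩
          2 * W                                  ≡⟨ ≡-sym (trans (∑-cong 𝓣 (λ P → trans (∑-*ˡ 𝓣 2 (joins P)) (cong (2 *_) (∑-tuples-∏ V t (link P))))) (∑-*ˡ 𝓣 2 _)) ⟩
          ∑ 𝓣 (λ P → ∑ 𝓣 (λ Q → 2 * joins P Q))  ∎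
          where
          open ≤-Reasoning
          𝓣 = tuples V t
          W = ∑ 𝓣 (λ P → codeg P ^ t)

        pruned : ∃[ 𝓛 ] 𝓛 ⊆ tuples V t × (∀ {P} → P ∈ 𝓛 → weight P ≤ 2 * ∑ 𝓛 (λ Q → 2 * joins P Q)) × ∃[ P ] P ∈ 𝓛
        pruned = prune weight (λ P Q → 2 * joins P Q) (λ P Q → cong (2 *_) (joins-sym P Q)) (tuples V t) dense′

        𝓛 : List (List (Fin n))
        𝓛 = proj₁ pruned

        𝓛⊆ : 𝓛 ⊆ tuples V t
        𝓛⊆ = proj₁ (proj₂ pruned)

        𝓛-length : ∀ {P} → P ∈ 𝓛 → length P ≡ t
        𝓛-length P∈ = ∈-tuples⁻ V t (Sublist.lookup 𝓛⊆ P∈)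

        record Extension (P Y : List (Fin n)) : Set where
          field
            ext        : List (Fin n)
            ext∈       : ext ∈ 𝓛
            ext-joined : Joined G P ext
            ext-unique : Unique ext
            ext-avoids : ∀ {x} → x ∈ ext → x ∉ Y
        open Extension

        -- Otherwise every surviving tuple joined to `P` has a coincidence, within itself or with
        -- `Y`; `∑-coincidences` allows too few such tuples, and `balance` gives the contradiction.
        -- The length `t + q * t` leaves room for a parent and `q` children.
        extend : ∀ {P} → P ∈ 𝓛 → ∀ Y → length Y ≤ t + q * t → Extension P Y
        extend {P} P∈ Y Y-short with any? (λ Q → (¬? (joins P Q ≟ 0)) ×-dec (coincidences Y Q ≟ 0)) 𝓛
        ... | yes some with find some
        ...   | Q , Q∈ , PQ≢0 , fresh = record
          { ext = Q ; ext∈ = Q∈ ; ext-joined = joins-Joined P Q PQ≢0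
          ; ext-unique = fresh-unique Y Q fresh ; ext-avoids = fresh-avoids Y Q fresh }
        extend {P} P∈ Y Y-short | no none = ⊥-elim (balance {t} {m} {codeg P} {t * (t + q * t + t)} {a} 0<t m-large lower total upper)
          where
          open ≤-Reasoning
          a = ∑ 𝓛 (joins P)
          lower : codeg P ^ t + m ^ t ≤ 4 * a
          lower = ≤-trans (proj₁ (proj₂ (proj₂ pruned)) P∈)
            (≤-reflexive (trans (cong (2 *_) (∑-*ˡ 𝓛 2 (joins P))) (≡-sym (*-assoc 2 2 a))))
          total : a ≤ codeg P ^ t
          total = ≤-trans (∑-⊆ (joins P) 𝓛⊆) (≤-reflexive (∑-tuples-∏ V t (link P)))
          -- A joined tuple has at least one coincidence here, so it may be weighted by their
          -- number.
          stale : ∀ {Q} → Q ∈ 𝓛 → joins P Q ≤ joins P Q * coincidences Y Q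
          stale {Q} Q∈ with joins P Q ≟ 0 | coincidences Y Q in eq
          ... | yes PQ≡0 | c     = ≤-trans (≤-reflexive PQ≡0) z≤n
          ... | no  PQ≢0 | zero  = contradiction (PQ≢0 , eq) (All.lookup (¬Any⇒All¬ 𝓛 none) Q∈)
          ... | no  _    | suc c = m≤m*n _ (suc c)
          upper : a * codeg P ≤ t * (t + q * t + t) * codeg P ^ t
          upper = begin
            a * codeg P
              ≤⟨ *-monoˡ-≤ (codeg P) (≤-trans (∑-mono-∈ 𝓛 stale) (∑-⊆ _ 𝓛⊆)) ⟩
            ∑ (tuples V t) (λ Q → joins P Q * coincidences Y Q) * codeg P
              ≤⟨ ∑-coincidences (allFin⁺ n) (link P) (λ v → ∏-≤1 P _ (λ u → bit≤1 _)) t Y ⟩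
            t * (length Y + t) * codeg P ^ t
              ≤⟨ *-monoˡ-≤ (codeg P ^ t) (*-monoʳ-≤ t (+-monoˡ-≤ t Y-short)) ⟩
            t * (t + q * t + t) * codeg P ^ t ∎

        -- `used` accumulates `Y` and the children chosen so far, so that a new child has a single
        -- list to avoid.
        record Children (P Y : List (Fin n)) (j : ℕ) : Set where
          field
            child        : Fin j → List (Fin n)
            child∈       : ∀ i → child i ∈ 𝓛
            child-joined : ∀ i → Joined G P (child i)
            child-unique : ∀ i → Unique (child i)
            child-avoids : ∀ i → Disjoint Y (child i)
            children-disjoint : ∀ {i i′} → i ≢ i′ → Disjoint (child i) (child i′)
            used         : List (Fin n)
            used-length  : length used ≤ length Y + j * t
            child⊆used   : ∀ i {x} → x ∈ child i → x ∈ used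
            Y⊆used       : ∀ {x} → x ∈ Y → x ∈ used
        open Children

        children : ∀ {P} → P ∈ 𝓛 → ∀ Y → length Y ≤ t → ∀ j → j ≤ q → Children P Y j
        children P∈ Y Y≤t zero j≤q = record
          { child = λ () ; child∈ = λ () ; child-joined = λ () ; child-unique = λ ()
          ; child-avoids = λ () ; children-disjoint = λ { {()} } ; used = Y
          ; used-length = ≤-reflexive (≡-sym (+-identityʳ _)) ; child⊆used = λ () ; Y⊆used = id }
        children P∈ Y Y≤t (suc j) j<q = record
          { child = λ { Fin.zero → ext e ; (Fin.suc i) → child c i }
          ; child∈ = λ { Fin.zero → ext∈ e ; (Fin.suc i) → child∈ c i }
          ; child-joined = λ { Fin.zero → ext-joined e ; (Fin.suc i) → child-joined c i }
          ; child-unique = λ { Fin.zero → ext-unique e ; (Fin.suc i) → child-unique c i }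
          ; child-avoids = λ { Fin.zero (x∈Y , x∈e) → ext-avoids e x∈e (Y⊆used c x∈Y) ; (Fin.suc i) → child-avoids c i }
          ; children-disjoint = λ
              { {Fin.zero}  {Fin.zero}   i≢i′ → contradiction refl i≢i′
              ; {Fin.zero}  {Fin.suc i′} _ (x∈e , x∈c) → ext-avoids e x∈e (child⊆used c i′ x∈c)
              ; {Fin.suc i} {Fin.zero}   _ (x∈c , x∈e) → ext-avoids e x∈e (child⊆used c i x∈c)
              ; {Fin.suc i} {Fin.suc i′} i≢i′ → children-disjoint c (i≢i′ ∘ cong Fin.suc) }
          ; used = ext e ++ used c
          ; used-length = begin
              length (ext e ++ used c)          ≡⟨ length-++ (ext e) ⟩
              length (ext e) + length (used c)  ≤⟨ +-mono-≤ (≤-reflexive (𝓛-length (ext∈ e))) (used-length c) ⟩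
              t + (length Y + j * t)            ≡⟨ +-left-comm t (length Y) (j * t) ⟩
              length Y + (t + j * t)            ∎
          ; child⊆used = λ { Fin.zero → ∈-++⁺ˡ ; (Fin.suc i) x∈c → ∈-++⁺ʳ (ext e) (child⊆used c i x∈c) }
          ; Y⊆used = λ x∈Y → ∈-++⁺ʳ (ext e) (Y⊆used c x∈Y) }
          where
          open ≤-Reasoning
          c = children P∈ Y Y≤t j (<⇒≤ j<q)
          e = extend P∈ (used c) (≤-trans (used-length c) (+-mono-≤ Y≤t (*-monoˡ-≤ t (<⇒≤ j<q))))

        -- `par` is the previous block, which the children must avoid; this yields `grandparent`.
        -- Its length is only bounded above because the root starts with an empty `par`.
        record RichState : Set where
          field
            cur        : List (Fin n)
            cur∈       : cur ∈ 𝓛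
            cur-unique : Unique cur
            par        : List (Fin n)
            par-length : length par ≤ t
        open RichState

        offspring : (X : RichState) → Children (cur X) (par X) q
        offspring X = children (cur∈ X) (par X) (par-length X) q ≤-refl

        descend : RichState → Fin q → RichState
        descend X i = record
          { cur = child (offspring X) i ; cur∈ = child∈ (offspring X) i
          ; cur-unique = child-unique (offspring X) i
          ; par = cur X ; par-length = ≤-reflexive (𝓛-length (cur∈ X)) }

      rich-branching : Branching G t q
      rich-branching = record
        { State = RichState
        ; block = cur
        ; next = descend
        ; block-length = λ X → 𝓛-length (cur∈ X)
        ; block-unique = cur-unique
        ; next-joined = λ X i → child-joined (offspring X) i
        ; siblings = λ X → children-disjoint (offspring X)
        ; grandparent = λ X i j → child-avoids (offspring (descend X i)) j }

      -- A tuple that survives pruning may repeat entries; an extension of it has distinct ones and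
      -- can serve as the root.
      root-state : Branching.State rich-branching
      root-state = record
        { cur = ext e ; cur∈ = ext∈ e ; cur-unique = ext-unique e ; par = [] ; par-length = z≤n }
        where e = extend (proj₂ (proj₂ (proj₂ (proj₂ pruned)))) [] z≤n

-- Paths in a branching structure

walk-mono : ∀ {n} {E : Fin n → Fin n → Bool} {k l u v} → k ≤ l → WalkLe E k u v → WalkLe E l u v
walk-mono k≤l       here        = here
walk-mono (s≤s k≤l) (step uw p) = step uw (walk-mono k≤l p)

module InducedSubgraph {n : ℕ} (G : Graph n) (VL : List (Fin n)) where

  inVL : Fin n → Bool
  inVL v = ⌊ v ∈? VL ⌋

  induced : Subgraph G
  induced = record
    { vert     = inVL
    ; edge     = λ u v → (inVL u ∧ inVL v) ∧ adj G u v
    ; edge-sym = λ u v → cong₂ _∧_ (∧-comm (inVL u) (inVL v)) (Graph.sym G u v)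
    ; edge-adj = λ u v uv → proj₂ (∧⁻ (inVL u ∧ inVL v) _ uv)
    ; edge-vl  = λ u v uv → proj₁ (∧⁻ (inVL u) (inVL v) (proj₁ (∧⁻ (inVL u ∧ inVL v) _ uv)))
    ; edge-vr  = λ u v uv → proj₂ (∧⁻ (inVL u) (inVL v) (proj₁ (∧⁻ (inVL u ∧ inVL v) _ uv))) }
    where
    ∧⁻ : ∀ b c → T (b ∧ c) → T b × T c
    ∧⁻ b c = Equivalence.to (T-∧ {b} {c})

  vert⁺ : ∀ {v} → v ∈ VL → T (inVL v)
  vert⁺ = fromWitness

  vert⁻ : ∀ {v} → T (inVL v) → v ∈ VL
  vert⁻ = toWitness

  edge⁺ : ∀ {u v} → u ∈ VL → v ∈ VL → T (adj G u v) → T (edge induced u v)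
  edge⁺ {u} {v} u∈ v∈ uv =
    Equivalence.from (T-∧ {inVL u ∧ inVL v}) (Equivalence.from (T-∧ {inVL u}) (vert⁺ u∈ , vert⁺ v∈) , uv)

  bit-T : ∀ {b} → T b → bit b ≡ 1
  bit-T {true} _ = refl

  nVert-induced : nVert induced ≤ length VL
  nVert-induced = begin
    countF inVL                             ≡⟨ countF-∑ inVL ⟩
    ∑ (allFin n) (bit ∘ inVL)               ≤⟨ ∑-mono (allFin n) covered ⟩
    ∑ (allFin n) (λ v → ∑ VL (λ x → δ x v)) ≡⟨ ∑-swap (allFin n) VL _ ⟩
    ∑ VL (λ x → ∑ (allFin n) (δ x))         ≡⟨ ∑-cong VL (λ x → ∑-cong (allFin n) (δ-sym x)) ⟩
    ∑ VL (λ x → ∑ (allFin n) (λ v → δ v x)) ≤⟨ ∑-mono VL (∑-δ-unique (allFin⁺ n)) ⟩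
    ∑ VL (λ _ → 1)                          ≡⟨ ∑-1 VL ⟩
    length VL                               ∎
    where
    open ≤-Reasoning
    covered : ∀ v → bit (inVL v) ≤ ∑ VL (λ x → δ x v)
    covered v with v ∈? VL
    ... | yes v∈ = ∑-δ-∈ v∈
    ... | no  _  = z≤n

  Rich : ℕ → Fin n → Set
  Rich d v = ∃[ Z ] Unique Z × d ≤ length Z × (∀ {z} → z ∈ Z → z ∈ VL × T (adj G v z))

  degH-induced : ∀ {d v} → v ∈ VL → Rich d v → d ≤ degH induced v
  degH-induced {d} {v} v∈ (Z , Z-unique , d≤Z , nbr) = begin
    d                                       ≤⟨ d≤Z ⟩
    length Z                                ≡⟨ ≡-sym (∑-1 Z) ⟩
    ∑ Z (λ _ → 1)                           ≤⟨ ∑-mono-∈ Z (λ z∈ → ≤-reflexive (≡-sym (bit-T (edge⁺ v∈ (proj₁ (nbr z∈)) (proj₂ (nbr z∈)))))) ⟩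
    ∑ Z (bit ∘ edge induced v)              ≤⟨ ∑-unique-≤ Z-unique _ (λ {x} _ → ∈-allFin x) ⟩
    ∑ (allFin n) (bit ∘ edge induced v)     ≡⟨ ≡-sym (countF-∑ (edge induced v)) ⟩
    degH induced v                          ∎
    where open ≤-Reasoning

inhabited : {L : List A} → 0 < length L → ∃[ x ] x ∈ L
inhabited {L = x ∷ L} _ = x , here refl

module BranchingPaths {n : ℕ} {G : Graph n} {t q : ℕ} (𝓑 : Branching G t q) (0<t : 0 < t) where
  open Branching 𝓑

  data Path : ℕ → State → State → Set where
    []  : ∀ {X} → Path 0 X X
    _∷_ : ∀ {k X Y} (i : Fin q) → Path k (next X i) Y → Path (suc k) X Y

  infixl 5 _∷ʳᵖ_

  _∷ʳᵖ_ : ∀ {k X Y} → Path k X Y → ∀ i → Path (suc k) X (next Y i)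
  []      ∷ʳᵖ j = j ∷ []
  (i ∷ p) ∷ʳᵖ j = i ∷ (p ∷ʳᵖ j)

  first : ∀ {k X Y} → Path (suc k) X Y → Fin q
  first (i ∷ p) = i

  -- The starting block is left out, so that several paths from one root do not count it repeatedly.
  trace : ∀ {k X Y} → Path k X Y → List (Fin n)
  trace []              = []
  trace {X = X} (i ∷ p) = block (next X i) ++ trace p

  trace-length : ∀ {k X Y} (p : Path k X Y) → length (trace p) ≡ k * t
  trace-length []              = refl
  trace-length {X = X} (i ∷ p) = trans (length-++ (block (next X i))) (cong₂ _+_ (block-length _) (trace-length p))

  trace-∷ʳ : ∀ {k X Y} (p : Path k X Y) i {v} → v ∈ trace (p ∷ʳᵖ i) → v ∈ trace p ⊎ v ∈ block (next Y i)
  trace-∷ʳ []      j v∈ with ∈-++⁻ _ v∈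
  ... | inj₁ v∈B = inj₂ v∈B
  trace-∷ʳ {X = X} (i ∷ p) j v∈ with ∈-++⁻ (block (next X i)) v∈
  ... | inj₁ v∈X = inj₁ (∈-++⁺ˡ v∈X)
  ... | inj₂ v∈p with trace-∷ʳ p j v∈p
  ...   | inj₁ v∈  = inj₁ (∈-++⁺ʳ (block (next X i)) v∈)
  ...   | inj₂ v∈B = inj₂ v∈B

  trace-last : ∀ {k X Y} (p : Path (suc k) X Y) {v} → v ∈ block Y → v ∈ trace p
  trace-last (i ∷ [])                v∈ = ∈-++⁺ˡ v∈
  trace-last {X = X} (i ∷ p@(_ ∷ _)) v∈ = ∈-++⁺ʳ (block (next X i)) (trace-last p v∈)

  block-inhabited : ∀ X → ∃[ v ] v ∈ block X
  block-inhabited X = inhabited (subst (0 <_) (≡-sym (block-length X)) 0<t)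

  joined-sym : ∀ X i {u v} → u ∈ block (next X i) → v ∈ block X → T (adj G u v)
  joined-sym X i {u} {v} u∈ v∈ = subst T (Graph.sym G v u) (next-joined X i v∈ u∈)

  -- The path stops at the penultimate block, and `last` leads from there to `B`. The target is a
  -- block and not a state, since different states can have the same block.
  record Hit (k : ℕ) (X : State) (B : List (Fin n)) : Set where
    field
      end  : State
      path : Path k X end
      last : Fin q
      hits : block (next end last) ≡ B
  open Hit

  -- Petals lie in penultimate blocks, so each is adjacent to all of `B`; they provide the degree
  -- `2 * t` at the vertices of `B`.
  record Bouquet (k : ℕ) (X : State) (B : List (Fin n)) : Set where
    field
      paths        : List (Hit k X B)
      few          : length paths ≤ suc t
      petals       : List (Fin n)
      petal-unique : Unique petals
      petal-many   : 2 * t ≤ length petals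
      petal-hit    : ∀ {u} → u ∈ petals → Any (λ h → u ∈ block (end h)) paths

  -- The length `suc k` ensures that there is a first step; by `siblings`, two different ones give
  -- the root block two disjoint children.
  record Fork (k : ℕ) (X : State) (B : List (Fin n)) : Set where
    field
      bouquet : Bouquet (suc k) X B
    open Bouquet bouquet public
    field
      {left right} : Hit (suc k) X B
      left∈   : left ∈ paths
      right∈  : right ∈ paths
      diverge : first (path left) ≢ first (path right)

  tail-hit : ∀ {k X B i} (h : Hit (suc k) X B) → first (path h) ≡ i →
             Σ (Hit k (next X i) B) λ h′ → end h′ ≡ end h
  tail-hit record { end = Y ; path = i ∷ p ; last = j ; hits = eq } refl =
    record { end = Y ; path = p ; last = j ; hits = eq } , refl

  tail-hits : ∀ {k X B i} (hs : List (Hit (suc k) X B)) → All (λ h → first (path h) ≡ i) hs →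
              Σ (List (Hit k (next X i) B)) λ hs′ → length hs′ ≡ length hs ×
                (∀ {u} → Any (λ h → u ∈ block (end h)) hs → Any (λ h → u ∈ block (end h)) hs′)
  tail-hits []       []         = [] , refl , λ ()
  tail-hits (h ∷ hs) (eq ∷ eqs) with tail-hit h eq | tail-hits hs eqs
  ... | h′ , end≡ | hs′ , len , transport =
    h′ ∷ hs′ , cong suc len ,
    λ { (here u∈) → here (subst (λ Y → _ ∈ block Y) (≡-sym end≡) u∈) ; (there any) → there (transport any) }

  -- Strip the common prefix: it ends before the bouquet does, because one block alone has only t < 2t vertices.
  trim : ∀ k {X B} → Bouquet k X B → ∃[ k′ ] k′ < k × ∃[ X′ ] Fork k′ X′ B
  trim zero {X} b = contradiction (≤-trans petal-many petals≤t) (<⇒≱ t<2t)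
    where
    open Bouquet b
    at-root : (hs : List (Hit 0 X _)) → ∀ {u} → Any (λ h → u ∈ block (end h)) hs → u ∈ block X
    at-root (record { path = [] } ∷ hs) (here u∈)  = u∈
    at-root (h ∷ hs)                    (there any) = at-root hs any
    petals≤t : length petals ≤ t
    petals≤t = ≤-trans (unique-length-≤ petal-unique (λ u∈ → at-root paths (petal-hit u∈))) (≤-reflexive (block-length X))
    t<2t : t < 2 * t
    t<2t = m<m+n t (≤-trans 0<t (m≤m+n t 0))
  trim (suc k) b@(record { paths = [] }) with inhabited (≤-trans (≤-trans 0<t (m≤m+n t _)) (Bouquet.petal-many b))
  ... | u , u∈ with () ← Bouquet.petal-hit b u∈
  trim (suc k) {X} b@(record { paths = h ∷ hs })
    with All.all? (λ h′ → first (path h′) ≟F first (path h)) (h ∷ hs)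
  ... | yes same with tail-hits (h ∷ hs) same
  ...   | hs′ , len , transport with trim k record
            { paths = hs′ ; few = ≤-trans (≤-reflexive len) (Bouquet.few b)
            ; petals = Bouquet.petals b ; petal-unique = Bouquet.petal-unique b
            ; petal-many = Bouquet.petal-many b ; petal-hit = transport ∘ Bouquet.petal-hit b }
  ...     | k′ , k′<k , X′ , fork = k′ , m≤n⇒m≤1+n k′<k , X′ , fork
  trim (suc k) {X} b@(record { paths = h ∷ hs }) | no differ with find (¬All⇒Any¬ (λ h′ → first (path h′) ≟F first (path h)) (h ∷ hs) differ)
  ... | h′ , h′∈ , h′≢h = k , ≤-refl , X , record
    { bouquet = b ; left∈ = h′∈ ; right∈ = here refl ; diverge = h′≢h }

  -- The subgraph spanned by a fork

  module _ {k X B} (fork : Fork k X B) where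
    open Fork fork

    private
      -- The root block and `B` enter once, not once per path; the bound on the number of vertices
      -- relies on this.
      VL : List (Fin n)
      VL = block X ++ (B ++ concatMap (trace ∘ path) paths)

    open InducedSubgraph G VL

    private
      X⊆ : ∀ {v} → v ∈ block X → v ∈ VL
      X⊆ = ∈-++⁺ˡ

      B⊆ : ∀ {v} → v ∈ B → v ∈ VL
      B⊆ = ∈-++⁺ʳ (block X) ∘ ∈-++⁺ˡ

      trace⊆ : ∀ {h} → h ∈ paths → ∀ {v} → v ∈ trace (path h) → v ∈ VL
      trace⊆ h∈ v∈ = ∈-++⁺ʳ (block X) (∈-++⁺ʳ B (∈-concatMap⁺ (trace ∘ path) (Any.map (λ { refl → v∈ }) h∈)))

      last⊆ : ∀ (h : Hit (suc k) X B) {v} → v ∈ block (next (end h) (last h)) → v ∈ VL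
      last⊆ h v∈ = B⊆ (subst (_ ∈_) (hits h) v∈)

      full⊆ : ∀ {h} → h ∈ paths → ∀ {v} → v ∈ trace (path h ∷ʳᵖ last h) → v ∈ VL
      full⊆ {h} h∈ v∈ with trace-∷ʳ (path h) (last h) v∈
      ... | inj₁ v∈p = trace⊆ h∈ v∈p
      ... | inj₂ v∈B = last⊆ h v∈B

      two-blocks : ∀ Y Z {v} → Disjoint (block Y) (block Z) →
                   (∀ {z} → z ∈ block Y → z ∈ VL × T (adj G v z)) →
                   (∀ {z} → z ∈ block Z → z ∈ VL × T (adj G v z)) → Rich (2 * t) v
      two-blocks Y Z {v} disj nbrY nbrZ =
        block Y ++ block Z , ++⁺ (block-unique Y) (block-unique Z) disj ,
        ≤-reflexive (≡-sym (trans (length-++ (block Y)) (cong₂ _+_ (block-length Y) (trans (block-length Z) (≡-sym (+-identityʳ t)))))) ,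
        λ z∈ → either (∈-++⁻ (block Y) z∈)
        where
        either : ∀ {z} → z ∈ block Y ⊎ z ∈ block Z → z ∈ VL × T (adj G v z)
        either (inj₁ z∈Y) = nbrY z∈Y
        either (inj₂ z∈Z) = nbrZ z∈Z

      sandwich : ∀ Y i j {v} → (∀ {z} → z ∈ block Y → z ∈ VL) → (∀ {z} → z ∈ block (next (next Y i) j) → z ∈ VL) →
                 v ∈ block (next Y i) → Rich (2 * t) v
      sandwich Y i j Y⊆ Z⊆ v∈ = two-blocks Y (next (next Y i) j) (grandparent Y i j)
        (λ z∈ → Y⊆ z∈ , joined-sym Y i v∈ z∈) (λ z∈ → Z⊆ z∈ , next-joined (next Y i) j v∈ z∈)

      -- The block containing `v` is joined to its predecessor and its successor, which are disjoint
      -- by `grandparent`. The extra step `j` supplies the successor of the last block; in a fork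
      -- this is `B`.
      rich-trace : ∀ {l Y Z} (p : Path l Y Z) j {v} → (∀ {z} → z ∈ block Y → z ∈ VL) →
                   (∀ {z} → z ∈ trace p → z ∈ VL) → (∀ {z} → z ∈ block (next Z j) → z ∈ VL) →
                   v ∈ trace p → Rich (2 * t) v
      rich-trace {Y = Y} (i ∷ p) j Y⊆ p⊆ Z⊆ v∈ with ∈-++⁻ (block (next Y i)) v∈
      ... | inj₂ v∈p = rich-trace p j (p⊆ ∘ ∈-++⁺ˡ) (p⊆ ∘ ∈-++⁺ʳ (block (next Y i))) Z⊆ v∈p
      rich-trace {Y = Y} (i ∷ [])      j Y⊆ p⊆ Z⊆ _ | inj₁ v∈i = sandwich Y i j Y⊆ Z⊆ v∈i
      rich-trace {Y = Y} (i ∷ (i′ ∷ p)) j Y⊆ p⊆ Z⊆ _ | inj₁ v∈i =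
        sandwich Y i i′ Y⊆ (p⊆ ∘ ∈-++⁺ʳ (block (next Y i)) ∘ ∈-++⁺ˡ) v∈i

      walk-trace : ∀ {l Y Z} (p : Path l Y Z) {c v} → (∀ {z} → z ∈ block Y → z ∈ VL) →
                   (∀ {z} → z ∈ trace p → z ∈ VL) → c ∈ block Y → v ∈ trace p → WalkLe (edge induced) l c v
      walk-trace {Y = Y} (i ∷ p) Y⊆ p⊆ c∈ v∈ with ∈-++⁻ (block (next Y i)) v∈ | block-inhabited (next Y i)
      ... | inj₁ v∈i | _      = step (edge⁺ (Y⊆ c∈) (p⊆ v∈) (next-joined Y i c∈ v∈i)) here
      ... | inj₂ v∈p | w , w∈ =
        step (edge⁺ (Y⊆ c∈) (p⊆ (∈-++⁺ˡ w∈)) (next-joined Y i c∈ w∈))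
             (walk-trace p (p⊆ ∘ ∈-++⁺ˡ) (p⊆ ∘ ∈-++⁺ʳ (block (next Y i))) w∈ v∈p)

      first⊆ : ∀ {h} → h ∈ paths → ∀ {v} → v ∈ block (next X (first (path h))) → v ∈ VL
      first⊆ {h} h∈ v∈ = trace⊆ h∈ (in-first (path h) v∈)
        where
        in-first : ∀ {l Y Z} (p : Path (suc l) Y Z) {v} → v ∈ block (next Y (first p)) → v ∈ trace p
        in-first (i ∷ p) v∈ = ∈-++⁺ˡ v∈

      data Place (v : Fin n) : Set where
        at-root  : v ∈ block X → Place v
        at-tip   : v ∈ B → Place v
        on-trace : ∀ {h} → h ∈ paths → v ∈ trace (path h) → Place v

      place : ∀ {v} → v ∈ VL → Place v
      place v∈ with ∈-++⁻ (block X) v∈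
      ... | inj₁ v∈X = at-root v∈X
      ... | inj₂ v∈rest with ∈-++⁻ B v∈rest
      ...   | inj₁ v∈B = at-tip v∈B
      ...   | inj₂ v∈t with find (∈-concatMap⁻ (trace ∘ path) {xs = paths} v∈t)
      ...     | h , h∈ , v∈h = on-trace h∈ v∈h

      rich : ∀ {v} → Place v → Rich (2 * t) v
      rich (at-root v∈) = two-blocks (next X (first (path left))) (next X (first (path right))) (siblings X diverge)
        (λ z∈ → first⊆ left∈ z∈ , next-joined X _ v∈ z∈) (λ z∈ → first⊆ right∈ z∈ , next-joined X _ v∈ z∈)
      rich {v} (at-tip v∈) = petals , petal-unique , petal-many , nbr
        where
        nbr : ∀ {z} → z ∈ petals → z ∈ VL × T (adj G v z)
        nbr z∈ with find (petal-hit z∈)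
        ... | h , h∈ , z∈h = trace⊆ h∈ (trace-last (path h) z∈h)
                           , joined-sym (end h) (last h) (subst (v ∈_) (≡-sym (hits h)) v∈) z∈h
      rich (on-trace {h} h∈ v∈) = rich-trace (path h) (last h) X⊆ (trace⊆ h∈) (last⊆ h) v∈

      -- The centre lies in the root block. `B` is reached in `suc (suc k)` steps, a trace in at
      -- most `suc k`, and the rest of the root block in 2 steps through a child.
      walk : ∀ {c v} → c ∈ block X → Place v → WalkLe (edge induced) (suc (suc k)) c v
      walk {c} {v} c∈ (at-root v∈) with block-inhabited (next X (first (path left)))
      ... | w , w∈ = step (edge⁺ (X⊆ c∈) (first⊆ left∈ w∈) (next-joined X _ c∈ w∈))
                    (step (edge⁺ (first⊆ left∈ w∈) (X⊆ v∈) (joined-sym X _ w∈ v∈)) here)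
      walk c∈ (at-tip v∈) = walk-trace (path left ∷ʳᵖ last left) X⊆ (full⊆ left∈) c∈
        (trace-last (path left ∷ʳᵖ last left) (subst (_ ∈_) (≡-sym (hits left)) v∈))
      walk c∈ (on-trace {h} h∈ v∈) = walk-mono (m≤n⇒m≤1+n ≤-refl) (walk-trace (path h) X⊆ (trace⊆ h∈) c∈ v∈)

      VL-length : length VL ≤ t + (t + suc t * (suc k * t))
      VL-length = begin
        length VL                                                 ≡⟨ length-++ (block X) ⟩
        length (block X) + length (B ++ concatMap (trace ∘ path) paths)
          ≡⟨ cong₂ _+_ (block-length X) (length-++ B) ⟩
        t + (length B + length (concatMap (trace ∘ path) paths))
          ≡⟨ cong (t +_) (cong₂ _+_ (trans (cong length (≡-sym (hits left))) (block-length _)) (≡-sym (∑-1 (concatMap (trace ∘ path) paths)))) ⟩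
        t + (t + ∑ (concatMap (trace ∘ path) paths) (λ _ → 1))
          ≡⟨ cong (λ s → t + (t + s)) (trans (∑-concatMap paths (trace ∘ path) _)
               (trans (∑-cong paths (λ h → trans (∑-1 (trace (path h))) (trace-length (path h)))) (∑-const paths _))) ⟩
        t + (t + length paths * (suc k * t))
          ≤⟨ +-monoʳ-≤ t (+-monoʳ-≤ t (*-monoˡ-≤ (suc k * t) few)) ⟩
        t + (t + suc t * (suc k * t)) ∎
        where open ≤-Reasoning

    fork-subgraph : 1 < t → ∀ {r} → suc (suc k) ≤ r →
      Σ (Subgraph G) λ H → MinDegGe H (2 * t) × RadLe H r × nVert H < r * t * t + r * t
    fork-subgraph 1<t {r} k+2≤r with block-inhabited X
    ... | c , c∈ = induced ,
      (λ v v∈ → degH-induced (vert⁻ v∈) (rich (place (vert⁻ v∈)))) ,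
      (c , vert⁺ (X⊆ c∈) , λ v v∈ → walk-mono k+2≤r (walk c∈ (place (vert⁻ v∈)))) ,
      (begin-strict
        nVert induced                                        ≤⟨ ≤-trans nVert-induced VL-length ⟩
        t + (t + suc t * (suc k * t))                        ≡⟨ cong (_+ (t + suc t * (suc k * t))) (≡-sym (*-identityʳ t)) ⟩
        -- Replacing one `t` by `t * t`, a strict increase as `1 < t`, gives exactly the bound with
        -- `suc (suc k)` for `r`.
        t * 1 + (t + suc t * (suc k * t))                    <⟨ +-monoˡ-< _ (*-monoʳ-< t ⦃ >-nonZero 0<t ⦄ 1<t) ⟩
        t * t + (t + suc t * (suc k * t))                    ≡⟨ regroup t k ⟩
        suc (suc k) * t * t + suc (suc k) * t                ≤⟨ +-mono-≤ (*-monoˡ-≤ t (*-monoˡ-≤ t k+2≤r)) (*-monoˡ-≤ t k+2≤r) ⟩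
        r * t * t + r * t                                    ∎)
      where
      open ≤-Reasoning
      regroup : ∀ t k → t * t + (t + suc t * (suc k * t)) ≡ suc (suc k) * t * t + suc (suc k) * t
      regroup = solve-∀

  -- Counting paths by their final block

  private
    module δL = Coincidences (≡-dec (_≟F_ {n}))

    V : List (Fin n)
    V = allFin n

    -- The number of `t`-tuples over `2 * t` vertices: a bound on the penultimate blocks that fit
    -- into a small cover.
    K : ℕ
    K = (2 * t) ^ t

  Leads : List (Fin n) → State → Set
  Leads B Y = ∃[ i ] block (next Y i) ≡ B

  leads? : ∀ B Y → Dec (Leads B Y)
  leads? B Y = any?F (λ i → ≡-dec _≟F_ (block (next Y i)) B)

  Cover : ℕ → List (Fin n) → List State → Set
  Cover c B Ys = ∃[ U ] length U ≤ c × (∀ {Y} → Y ∈ Ys → Leads B Y → ∀ {u} → u ∈ block Y → u ∈ U)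

  module _ {k : ℕ} {X : State} (Ps : List (Σ State (Path k X))) (B : List (Fin n)) where

    private
      Ys : List State
      Ys = map proj₁ Ps

      as-hit : ∀ {Y} → Y ∈ Ys → Leads B Y → Σ (Hit k X B) λ h → Hit.end h ≡ Y
      as-hit Y∈ (i , eq) with ∈-map⁻ proj₁ Y∈
      ... | (Y , p) , _ , refl = record { end = Y ; path = p ; last = i ; hits = eq } , refl

      -- Each new path contributes a new vertex, so t + 1 paths suffice to reach 2t vertices.
      collect : ∀ fuel (hs : List (Hit k X B)) (U : List (Fin n)) → Unique U →
                (∀ {u} → u ∈ U → Any (λ h → u ∈ block (Hit.end h)) hs) →
                length hs ≤ suc t → t + length hs ≤ suc (length U) → 2 * t ≤ length U + fuel →
                Bouquet k X B ⊎ Cover (2 * t) B Ys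
      collect fuel hs U U-unique U-hit hs≤ progress U+fuel with 2 * t ≤? length U
      ... | yes 2t≤U = inj₁ record
        { paths = hs ; few = hs≤ ; petals = U ; petal-unique = U-unique ; petal-many = 2t≤U ; petal-hit = U-hit }
      collect zero hs U _ _ _ _ U+fuel | no 2t≰U =
        contradiction (≤-trans U+fuel (≤-reflexive (+-identityʳ _))) 2t≰U
      collect (suc fuel) hs U U-unique U-hit hs≤ progress U+fuel | no 2t≰U
        with any? (λ Y → leads? B Y ×-dec any? (λ u → ¬? (u ∈? U)) (block Y)) Ys
      ... | no none = inj₂ (U , <⇒≤ (≰⇒> 2t≰U) , covered)
        where
        covered : ∀ {Y} → Y ∈ Ys → Leads B Y → ∀ {u} → u ∈ block Y → u ∈ U
        covered Y∈ leads {u} u∈ with u ∈? U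
        ... | yes u∈U = u∈U
        ... | no  u∉U = contradiction (leads , Any.map (λ { refl → u∉U }) u∈) (All.lookup (¬Any⇒All¬ Ys none) Y∈)
      ... | yes some with find some
      ...   | Y , Y∈ , leads , new with find new | as-hit Y∈ leads
      ...     | u , u∈ , u∉U | h , refl = collect fuel (h ∷ hs) (u ∷ U)
        (All.tabulate (λ { z∈U refl → u∉U z∈U }) ∷ U-unique)
        (λ { (here refl) → here u∈ ; (there z∈U) → there (U-hit z∈U) })
        -- `progress` and `length U < 2 * t` give `length hs ≤ t`, which leaves room for one more
        -- path.
        (s≤s (+-cancelˡ-≤ t _ _ (≤-trans progress (≤-trans (≰⇒> 2t≰U) (≤-reflexive (cong (t +_) (+-identityʳ t)))))))
        (≤-trans (≤-reflexive (+-suc t (length hs))) (s≤s progress))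
        (≤-trans U+fuel (≤-reflexive (+-suc (length U) fuel)))

    bouquet-or-cover : Bouquet k X B ⊎ Cover (2 * t) B Ys
    bouquet-or-cover with any? (leads? B) Ys
    ... | no none = inj₂ ([] , z≤n , λ Y∈ leads → contradiction leads (All.lookup (¬Any⇒All¬ Ys none) Y∈))
    ... | yes some with find some
    ...   | Y , Y∈ , leads with as-hit Y∈ leads
    -- The first path contributes all `t` vertices of its block, and `progress` starts with
    -- equality.
    ...     | h , refl = collect (2 * t) (h ∷ []) (block Y) (block-unique Y) here (s≤s z≤n)
                (≤-reflexive (trans (+-comm t 1) (cong suc (≡-sym (block-length Y))))) (m≤n+m (2 * t) (length (block Y)))

  module _ (X : State) where

    paths-from : ∀ k → List (Σ State (Path k X))
    paths-from zero    = [ X , [] ]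
    paths-from (suc k) = concatMap (λ { (Y , p) → map (λ i → next Y i , p ∷ʳᵖ i) (allFin q) }) (paths-from k)

    ends : ∀ k → List State
    ends k = map proj₁ (paths-from k)

    ∑-ends-suc : ∀ k (f : State → ℕ) → ∑ (ends (suc k)) f ≡ ∑ (ends k) (λ Y → ∑ (allFin q) (λ i → f (next Y i)))
    ∑-ends-suc k f = trans (∑-map (paths-from (suc k)) proj₁ f)
      (trans (∑-concatMap (paths-from k) _ (f ∘ proj₁))
        (trans (∑-cong (paths-from k) (λ { (Y , p) → ∑-map (allFin q) _ (f ∘ proj₁) }))
          (≡-sym (∑-map (paths-from k) proj₁ _))))

    length-ends : ∀ k → ∑ (ends k) (λ _ → 1) ≡ q ^ k
    length-ends zero    = refl
    length-ends (suc k) = begin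
      ∑ (ends (suc k)) (λ _ → 1)                  ≡⟨ ∑-ends-suc k _ ⟩
      ∑ (ends k) (λ _ → ∑ (allFin q) (λ _ → 1))   ≡⟨ ∑-cong (ends k) (λ _ → trans (trans (∑-1 (allFin q)) (length-tabulate {n = q} id)) (≡-sym (*-identityʳ q))) ⟩
      ∑ (ends k) (λ _ → q * 1)                    ≡⟨ ∑-*ˡ (ends k) q _ ⟩
      q * ∑ (ends k) (λ _ → 1)                    ≡⟨ cong (q *_) (length-ends k) ⟩
      q * q ^ k                                   ∎
      where open ≡-Reasoning

    -- Counts paths and not states: `ends k` lists a state once for every path to it.
    ending : ℕ → List (Fin n) → ℕ
    ending k B = ∑ (ends k) (λ Y → δL.δ B (block Y))

    block-injective : ∀ Y {i j} → block (next Y i) ≡ block (next Y j) → i ≡ j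
    block-injective Y {i} {j} eq with i ≟F j | block-inhabited (next Y i)
    ... | yes i≡j | _      = i≡j
    ... | no  i≢j | v , v∈ = contradiction (v∈ , subst (v ∈_) eq v∈) (siblings Y i≢j)

    -- Siblings have disjoint nonempty blocks, so at most one child of `Y` has block `B`.
    leads-bound : ∀ B Y (c : ℕ) → (Leads B Y → 1 ≤ c) → ∑ (allFin q) (λ i → δL.δ B (block (next Y i))) ≤ c
    leads-bound B Y c lead = ≤-trans (≤-reflexive as-list) bound
      where
      blocks : List (List (Fin n))
      blocks = map (λ i → block (next Y i)) (allFin q)
      as-list : ∑ (allFin q) (λ i → δL.δ B (block (next Y i))) ≡ ∑ blocks (λ Q → δL.δ Q B)
      as-list = trans (∑-cong (allFin q) (λ i → δL.δ-sym B _)) (≡-sym (∑-map (allFin q) _ _))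
      bound : ∑ blocks (λ Q → δL.δ Q B) ≤ c
      bound with leads? B Y
      ... | yes leads = ≤-trans (δL.∑-δ-unique (map⁺ (block-injective Y) (allFin⁺ q)) B) (lead leads)
      ... | no ¬leads = ≤-trans (≤-reflexive (δL.∑-δ-∉ blocks ¬lead)) z≤n
        where
        ¬lead : B ∉ blocks
        ¬lead B∈ with ∈-map⁻ (λ i → block (next Y i)) B∈
        ... | i , _ , eq = ¬leads (i , ≡-sym eq)

    -- By `leads-bound`, a path to `B` is determined by its part up to the penultimate block. That
    -- block is one of at most `K` tuples over `U`, each the end of at most `K ^ k` paths.
    ending-step : ∀ k B → Cover (2 * t) B (ends k) →
                  (∀ {S} → S ∈ tuples V t → ending k S ≤ K ^ k) → ending (suc k) B ≤ K ^ suc k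
    ending-step k B (U , U≤2t , covers) bound = begin
      ending (suc k) B                                               ≡⟨ ∑-ends-suc k _ ⟩
      ∑ (ends k) (λ Y → ∑ (allFin q) (λ i → δL.δ B (block (next Y i))))
        ≤⟨ ∑-mono-∈ (ends k) (λ {Y} Y∈ → leads-bound B Y _ (λ leads → δL.∑-δ-∈ (from-U Y (covers Y∈ leads)))) ⟩
      ∑ (ends k) (λ Y → ∑ (tuples U t) (λ S → δL.δ S (block Y)))     ≡⟨ ∑-swap (ends k) (tuples U t) _ ⟩
      ∑ (tuples U t) (ending k)                                      ≤⟨ ∑-mono-∈ (tuples U t) (λ S∈ → bound (everywhere S∈)) ⟩
      ∑ (tuples U t) (λ _ → K ^ k)                                   ≡⟨ ∑-const (tuples U t) _ ⟩
      length (tuples U t) * K ^ k                                    ≡⟨ cong (_* K ^ k) (length-tuples U t) ⟩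
      length U ^ t * K ^ k                                           ≤⟨ *-monoˡ-≤ (K ^ k) (^-monoˡ-≤ t U≤2t) ⟩
      K * K ^ k                                                      ∎
      where
      open ≤-Reasoning
      from-U : ∀ Y → (∀ {u} → u ∈ block Y → u ∈ U) → block Y ∈ tuples U t
      from-U Y Y⊆U = subst (λ l → block Y ∈ tuples U l) (block-length Y) (∈-tuples⁺ U (block Y) Y⊆U)
      everywhere : ∀ {S} → S ∈ tuples U t → S ∈ tuples V t
      everywhere {S} S∈ = subst (λ l → S ∈ tuples V l) (∈-tuples⁻ U t S∈) (∈-tuples⁺ V S (λ {x} _ → ∈-allFin x))

    module _ (r : ℕ) where

      Blossom : Set
      Blossom = ∃[ k ] k < r × ∃[ B ] Bouquet k X B

      -- A bouquet found at any level ends the induction; otherwise every `B` has a cover and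
      -- `ending-step` applies.
      ending-bound : ∀ k → k ≤ r → Blossom ⊎ (∀ {B} → B ∈ tuples V t → ending k B ≤ K ^ k)
      ending-bound zero    _   = inj₂ (λ {B} _ → ≤-trans (≤-reflexive (+-identityʳ _)) (bit≤1 _))
      ending-bound (suc k) k<r with ending-bound k (<⇒≤ k<r)
      ... | inj₁ blossom = inj₁ blossom
      ... | inj₂ bound   = all-or (tuples V t)
        where
        all-or : ∀ L → Blossom ⊎ (∀ {B} → B ∈ L → ending (suc k) B ≤ K ^ suc k)
        all-or []      = inj₂ λ ()
        all-or (B ∷ L) with bouquet-or-cover (paths-from k) B | all-or L
        ... | inj₁ bouquet | _            = inj₁ (k , k<r , B , bouquet)
        ... | inj₂ _       | inj₁ blossom = inj₁ blossom
        ... | inj₂ cover   | inj₂ bounds  =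
          inj₂ λ { (here refl) → ending-step k B cover bound ; (there B∈) → bounds B∈ }

      -- Pigeonhole: without a bouquet, each of the `n ^ t` tuples is the final block of at most
      -- `K ^ r` of the `q ^ r` paths.
      blossom : n ^ t * K ^ r < q ^ r → Blossom
      blossom crowded with ending-bound r ≤-refl
      ... | inj₁ b     = b
      ... | inj₂ bound = contradiction crowded (≤⇒≯ (begin
        q ^ r                                                      ≡⟨ ≡-sym (length-ends r) ⟩
        ∑ (ends r) (λ _ → 1)                                       ≤⟨ ∑-mono (ends r) (λ Y → δL.∑-δ-∈ (tuple Y)) ⟩
        ∑ (ends r) (λ Y → ∑ (tuples V t) (λ B → δL.δ B (block Y))) ≡⟨ ∑-swap (ends r) (tuples V t) _ ⟩
        ∑ (tuples V t) (ending r)                                  ≤⟨ ∑-mono-∈ (tuples V t) bound ⟩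
        ∑ (tuples V t) (λ _ → K ^ r)                               ≡⟨ ∑-const (tuples V t) _ ⟩
        length (tuples V t) * K ^ r                                ≡⟨ cong (_* K ^ r) (trans (length-tuples V t) (cong (_^ t) (length-tabulate {n = n} id))) ⟩
        n ^ t * K ^ r                                              ∎))
        where
        open ≤-Reasoning
        tuple : ∀ Y → block Y ∈ tuples V t
        tuple Y = subst (λ l → block Y ∈ tuples V l) (block-length Y) (∈-tuples⁺ V (block Y) (λ {x} _ → ∈-allFin x))

      branching-subgraph : 1 < t → n ^ t * K ^ r < q ^ r →
        Σ (Subgraph G) λ H → MinDegGe H (2 * t) × RadLe H r × nVert H < r * t * t + r * t
      branching-subgraph 1<t crowded with blossom crowded
      ... | k , k<r , B , bouquet with trim k bouquet
      ...   | k′ , k′<k , X′ , fork = fork-subgraph fork 1<t (≤-trans (s≤s k′<k) k<r)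

-- The constants

-- Stands in for real `r`-th roots: the lower bound will keep `m` small, the upper one will make
-- `q = suc s` large enough for `blossom`.
floor-root : ∀ r → 0 < r → ∀ x → ∃[ s ] s ^ r ≤ x × x < suc s ^ r
floor-root r@(suc _) 0<r zero = 0 , z≤n , m^n>0 1 r
floor-root r@(suc _) 0<r (suc x) with floor-root r 0<r x
... | s , sʳ≤x , x<ssʳ with suc x <? suc s ^ r
...   | yes sx<ssʳ = s , m≤n⇒m≤1+n sʳ≤x , sx<ssʳ
...   | no  sx≮ssʳ = suc s , ≮⇒≥ sx≮ssʳ , ≤-<-trans x<ssʳ (^-monoˡ-< r (n<1+n (suc s)))

-- `D`, `s` and `W` stand for the degree sum and the numbers of stars and bicliques. If `W` were at
-- most `n ^ t * m ^ t`, then `s` would be at most `n ^ t * m` and `D ^ t * n` at most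
-- `n ^ (2 * t) * m`. Raising this to the power `r` and comparing with the edge bound gives
-- `suc C ^ (r * t) ≤ C ^ r`, which is absurd.
many-bicliques : ∀ {n D s W m C r t} → 0 < n → 0 < r → 0 < t →
  suc C ^ (r * t) * n ^ ((2 * r * t + t) ∸ r) ≤ D ^ (r * t) → m ^ r ≤ C ^ r * n ^ t →
  D ^ t * n ≤ n ^ t * s → s ^ t * n ^ t ≤ (n ^ t) ^ t * W → n ^ t * m ^ t < W
many-bicliques {n} {D} {s} {W} {m} {C} {r} {t} 0<n 0<r 0<t big m-small stars bicliques =
  ≰⇒> λ W≤ → <⇒≱ C<α (*-cancelʳ-≤ _ _ (P ^ r * N) ⦃ m*n≢0 (P ^ r) N ⦄ (chain W≤))
  where
  open ≤-Reasoning
  N P : ℕ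
  N = n ^ t
  P = N * N
  instance
    n≢0 : NonZero n
    n≢0 = >-nonZero 0<n
    N≢0 : NonZero N
    N≢0 = m^n≢0 n t
    r≢0 : NonZero r
    r≢0 = >-nonZero 0<r
    t≢0 : NonZero t
    t≢0 = >-nonZero 0<t
    Pʳ≢0 : NonZero (P ^ r)
    Pʳ≢0 = m^n≢0 P r ⦃ m*n≢0 N N ⦄
  C<α : C ^ r < suc C ^ (r * t)
  C<α = <-≤-trans (^-monoˡ-< r (n<1+n C)) (^-monoʳ-≤ (suc C) (m≤m*n r t))
  s≤ : W ≤ N * m ^ t → s ≤ N * m
  s≤ W≤ = ^-cancelˡ-≤ t 0<t (*-cancelʳ-≤ _ _ N (begin
    s ^ t * N              ≤⟨ bicliques ⟩
    N ^ t * W              ≤⟨ *-monoʳ-≤ (N ^ t) W≤ ⟩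
    N ^ t * (N * m ^ t)    ≡⟨ *-right-comm (N ^ t) N (m ^ t) ⟩
    N ^ t * m ^ t * N      ≡⟨ cong (_* N) (≡-sym (^-distribʳ-* t N m)) ⟩
    (N * m) ^ t * N        ∎))
  -- The exponent of `n` in the edge bound is `r * t` times 2 - 1/t + 1/r; the subtraction does not
  -- truncate, by `r≤`.
  exponents : n ^ ((2 * r * t + t) ∸ r) * n ^ r ≡ P ^ r * N
  exponents = begin-equality
    n ^ ((2 * r * t + t) ∸ r) * n ^ r    ≡⟨ ≡-sym (^-distribˡ-+-* n ((2 * r * t + t) ∸ r) r) ⟩
    n ^ ((2 * r * t + t) ∸ r + r)        ≡⟨ cong (n ^_) (m∸n+n≡m r≤) ⟩
    n ^ (2 * r * t + t)                  ≡⟨ ^-distribˡ-+-* n (2 * r * t) t ⟩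
    n ^ (2 * r * t) * N                  ≡⟨ cong (λ e → n ^ e * N) (double r t) ⟩
    n ^ ((t + t) * r) * N                ≡⟨ cong (_* N) (≡-sym (^-*-assoc n (t + t) r)) ⟩
    (n ^ (t + t)) ^ r * N                ≡⟨ cong (λ p → p ^ r * N) (^-distribˡ-+-* n t t) ⟩
    P ^ r * N                            ∎
    where
    double : ∀ r t → 2 * r * t ≡ (t + t) * r
    double = solve-∀
    r≤ : r ≤ 2 * r * t + t
    r≤ = ≤-trans (m≤m+n r (r + 0)) (≤-trans (m≤m*n (2 * r) t) (m≤m+n (2 * r * t) t))
  chain : W ≤ N * m ^ t → suc C ^ (r * t) * (P ^ r * N) ≤ C ^ r * (P ^ r * N)
  chain W≤ = begin
    suc C ^ (r * t) * (P ^ r * N)                              ≡⟨ cong (suc C ^ (r * t) *_) (≡-sym exponents) ⟩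
    suc C ^ (r * t) * (n ^ ((2 * r * t + t) ∸ r) * n ^ r)      ≡⟨ ≡-sym (*-assoc (suc C ^ (r * t)) _ _) ⟩
    suc C ^ (r * t) * n ^ ((2 * r * t + t) ∸ r) * n ^ r        ≤⟨ *-monoˡ-≤ (n ^ r) big ⟩
    D ^ (r * t) * n ^ r                                        ≡⟨ cong (λ e → D ^ e * n ^ r) (*-comm r t) ⟩
    D ^ (t * r) * n ^ r                                        ≡⟨ cong (_* n ^ r) (≡-sym (^-*-assoc D t r)) ⟩
    (D ^ t) ^ r * n ^ r                                        ≡⟨ ≡-sym (^-distribʳ-* r (D ^ t) n) ⟩
    (D ^ t * n) ^ r                                            ≤⟨ ^-monoˡ-≤ r (≤-trans stars (*-monoʳ-≤ N (s≤ W≤))) ⟩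
    (N * (N * m)) ^ r                                          ≡⟨ cong (_^ r) (≡-sym (*-assoc N N m)) ⟩
    (P * m) ^ r                                                ≡⟨ ^-distribʳ-* r P m ⟩
    P ^ r * m ^ r                                              ≤⟨ *-monoʳ-≤ (P ^ r) m-small ⟩
    P ^ r * (C ^ r * N)                                        ≡⟨ *-left-comm (P ^ r) (C ^ r) N ⟩
    C ^ r * (P ^ r * N)                                        ∎

-- The left side is `1 + 12 * (t * t) + 4 * (t * t) * s`; as `s` and `t` are positive, the
-- coefficients add up to 17.
threshold-bound : ∀ {s t} → 0 < s → 0 < t → suc (4 * (t * (t + suc s * t + t))) ≤ 17 * (t * t) * s
threshold-bound {s} {t} 0<s 0<t = begin
  suc (4 * (t * (t + suc s * t + t)))                  ≡⟨ expand s t ⟩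
  1 + 12 * (t * t * 1) + 4 * (t * t) * s               ≤⟨ +-monoˡ-≤ _ (+-mono-≤ 1≤tts (*-monoʳ-≤ 12 (*-monoʳ-≤ (t * t) 0<s))) ⟩
  t * t * s + 12 * (t * t * s) + 4 * (t * t) * s       ≡⟨ collect s t ⟩
  17 * (t * t) * s                                     ∎
  where
  open ≤-Reasoning
  1≤tts : 1 ≤ t * t * s
  1≤tts = *-mono-≤ (*-mono-≤ 0<t 0<t) 0<s
  expand : ∀ s t → suc (4 * (t * (t + suc s * t + t))) ≡ 1 + 12 * (t * t * 1) + 4 * (t * t) * s
  expand = solve-∀
  collect : ∀ s t → t * t * s + 12 * (t * t * s) + 4 * (t * t) * s ≡ 17 * (t * t) * s
  collect = solve-∀

theorem4p6 : (r t : ℕ) → 2 ≤ r → 2 ≤ t →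
    Σ ℕ λ α → (n : ℕ) (G : Graph n) →
    α ^ (r * t) * n ^ ((2 * r * t + t) ∸ r) ≤ edges G ^ (r * t) →
    LogCond n t r →
    t * t ≤ n →
    Σ (Subgraph G) λ H →
    MinDegGe H (2 * t) × RadLe H r × nVert H < r * t * t + r * t
theorem4p6 r t 2≤r 2≤t = suc C , λ n G big _ t²≤n → subgraph n G big t²≤n
  where
  K C : ℕ
  K = (2 * t) ^ t
  -- Chosen so that `m ^ r ≤ C ^ r * n ^ t`; the constant of the theorem is larger by one, which
  -- makes `C<α` strict.
  C = 17 * (t * t) * K

  0<r : 0 < r
  0<r = <⇒≤ 2≤r

  0<t : 0 < t
  0<t = <⇒≤ 2≤t

  subgraph : (n : ℕ) (G : Graph n) → suc C ^ (r * t) * n ^ ((2 * r * t + t) ∸ r) ≤ edges G ^ (r * t) →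
             t * t ≤ n → Σ (Subgraph G) λ H → MinDegGe H (2 * t) × RadLe H r × nVert H < r * t * t + r * t
  -- `s` is the integer part of `K` times `n` to the power t/r, and `suc s` will be the number of
  -- children.
  subgraph n G big t²≤n with floor-root r 0<r (n ^ t * K ^ r)
  ... | s , sʳ≤ , <ssʳ =
    BranchingPaths.branching-subgraph (rich-branching G t (suc s) m 0<t ≤-refl dense) 0<t
      (root-state G t (suc s) m 0<t ≤-refl dense) r 2≤t <ssʳ
    where
    open ≤-Reasoning
    m : ℕ
    m = suc (4 * (t * (t + suc s * t + t)))
    0<n : 0 < n
    0<n = ≤-trans (*-mono-≤ 0<t 0<t) t²≤n
    instance
      n≢0 : NonZero n
      n≢0 = >-nonZero 0<n
      2t≢0 : NonZero (2 * t)
      2t≢0 = >-nonZero (≤-trans 0<t (m≤m+n t _))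
    0<s : 0 < s
    -- For `s = 0` the upper bound would read `n ^ t * K ^ r < 1`.
    0<s = n≢0⇒n>0 λ { refl → <⇒≱ <ssʳ (≤-trans (≤-reflexive (^-zeroˡ r)) (*-mono-≤ (m^n>0 n t) (m^n>0 K ⦃ m^n≢0 (2 * t) t ⦄ r))) }
    m-small : m ^ r ≤ C ^ r * n ^ t
    m-small = begin
      m ^ r                                       ≤⟨ ^-monoˡ-≤ r (threshold-bound 0<s 0<t) ⟩
      (17 * (t * t) * s) ^ r                      ≡⟨ ^-distribʳ-* r (17 * (t * t)) s ⟩
      (17 * (t * t)) ^ r * s ^ r                  ≤⟨ *-monoʳ-≤ ((17 * (t * t)) ^ r) sʳ≤ ⟩
      (17 * (t * t)) ^ r * (n ^ t * K ^ r)        ≡⟨ *-right-comm ((17 * (t * t)) ^ r) (n ^ t) (K ^ r) ⟩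
      (17 * (t * t)) ^ r * K ^ r * n ^ t          ≡⟨ cong (_* n ^ t) (≡-sym (^-distribʳ-* r (17 * (t * t)) K)) ⟩
      C ^ r * n ^ t                               ∎
    dense : n ^ t * m ^ t < ∑ (tuples (allFin n) t) (λ P → codeg G P ^ t)
    dense = many-bicliques {r = r} 0<n 0<r 0<t
      (≤-trans big (^-monoˡ-≤ (r * t) (edges≤∑deg G))) m-small (stars-bound G t) (bicliques-bound G t)
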